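{- Let $p$ be an odd prime and let $\mathbb{P}=\mathbb{C}_p[x]$. For every polynomial $q(x)\in\mathbb{P}$, $$\Big\langle \int_{\mathbb{Z}_p}e^{yt}\,d\mu_{ -1}(y)\,\Big|\, q(x)\Big\rangle=\int_{\mathbb{Z}_p}q(u)\,d\mu_{ -1}(u),$$ that is, $$\Big\langle \frac{2}{e^t+1}\,\Big|\, q(x)\Big\rangle=\int_{\mathbb{Z}_p}q(u)\,d\mu_{ -1}(u).$$ Also, for every integer $n\ge 0$, the $n$-th Euler number is given by $$E_n=\Big\langle \int_{\mathbb{Z}_p}e^{yt}\,d\mu_{ -1}(y)\,\Big|\, x^n\Big\rangle .$$
   Context: $p$ is a fixed odd prime; $\mathbb{Z}_p$ is the ring of $p$-adic integers and $\mathbb{C}_p$ is the completion of the algebraic closure of $\mathbb{Q}_p$. Fermionic $p$-adic integral: for a continuous function $f:\mathbb{Z}_p\to\mathbb{C}_p$, $$\int_{\mathbb{Z}_p}f(x)\,d\mu_{ -1}(x)=\lim_{N\to\infty}\sum_{x=0}^{p^N-1}f(x)(-1)^x .$$ Umbral algebra: $\mathcal{F}$ is the algebra of formal power series $f(t)=\sum_{k\ge0}\frac{a_k}{k!}t^k$ with $a_k\in\mathbb{C}_p$. Each such $f(t)$ defines a linear functional on $\mathbb{P}=\mathbb{C}_p[x]$, written $\langle f(t)\,|\,q(x)\rangle$, determined by linearity and $\langle f(t)\,|\,x^n\rangle=a_n$ for all $n\ge0$. The symbol $\int_{\mathbb{Z}_p}e^{yt}\,d\mu_{ -1}(y)$ denotes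 the formal power series $\sum_{k\ge0}\left(\int_{\mathbb{Z}_p}y^k\,d\mu_{ -1}(y)\right)\frac{t^k}{k!}\in\mathcal{F}$. The statement includes the identification of this series with $\frac{2}{e^t+1}\in\mathcal{F}$, where $e^t=\sum_{k\ge0}t^k/k!$ and the quotient is taken in the ring of formal power series. Euler numbers $E_n$ are defined by $\frac{2}{e^t+1}=\sum_{n\ge0}E_n\frac{t^n}{n!}$. -}

module Defs where

open import Level using (Level; _⊔_; 0ℓ) renaming (suc to lsuc)
open import Algebra.Bundles using (CommutativeRing)
open import Algebra.Apartness.Bundles using (HeytingField; HeytingCommutativeRing)
open import Algebra.Morphism.Structures using (module RingMorphisms)
import Algebra.Definitions
import Algebra.Morphism.Construct.Composition as Composition
import Algebra.Properties.AbelianGroup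
import Algebra.Properties.CommutativeSemigroup
import Algebra.Properties.Ring
import Algebra.Properties.Semiring.Mult
import Algebra.Properties.Semiring.Exp
import Algebra.Properties.Semiring.Sum
import Algebra.Structures
import Relation.Binary.Reasoning.Setoid
open import Data.Nat.Base as ℕ using (ℕ; zero; suc; _∸_; _!)
import Data.Nat.Properties as ℕP
open import Data.Nat.Divisibility as Div using (_∣_; _∤_)
open import Data.Nat.Induction using (<-rec)
open import Data.Nat.Primality using (Prime; prime⇒nonZero; prime⇒nonTrivial; euclidsLemma)
open import Data.Integer.Base as ℤ using (ℤ; +_)
import Data.Integer.Properties as ℤP
open import Data.Rational.Base as ℚ using (ℚ; 0ℚ; 1ℚ; ½)
import Data.Rational.Properties as ℚP
import Data.Nat.Coprimality as Coprime
import Data.Rational.Unnormalised.Base as ℚᵘ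
import Data.Rational.Unnormalised.Properties as ℚᵘP
open import Data.Rational.Solver using (module +-*-Solver)
open import Data.Fin.Base using (Fin; toℕ)
open import Data.List.Base using (List; []; _∷_; _++_; map; length; lookup; replicate)
open import Data.Product.Base using (Σ; ∃; ∃₂; ∃-syntax; Σ-syntax; _×_; _,_; proj₁; proj₂)
open import Data.Sum.Base using (_⊎_; inj₁; inj₂)
open import Function.Base using (_∘_)
open import Function.Bundles using (_⇔_; module Equivalence)
open import Relation.Nullary using (¬_; yes; no; contradiction)
open import Relation.Binary.PropositionalEquality as ≡ using (_≡_)

private
  variable
    c ℓ ℓ₁ ℓ₂ r : Level

  open Algebra.Structures using (IsCommutativeRing)

  ∃δ : ∀ {ε B} → 0ℚ ℚ.< ε → 0ℚ ℚ.< B → ∃[ δ ] 0ℚ ℚ.< δ × B ℚ.* δ ≡ ε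
  ∃δ {ε} {B} ε>0 B>0 = ε ℚ.* (ℚ.1/ B) , δ>0 , eq
    where
    instance
      posB : ℚ.Positive B
      posB = ℚ.positive B>0
      posε : ℚ.Positive ε
      posε = ℚ.positive ε>0
      nzB : ℚ.NonZero B
      nzB = ℚP.pos⇒nonZero B
      pos1/B : ℚ.Positive (ℚ.1/ B)
      pos1/B = ℚP.1/pos⇒pos B
    δ>0 : 0ℚ ℚ.< ε ℚ.* (ℚ.1/ B)
    δ>0 = ℚP.positive⁻¹ _ {{ℚP.pos*pos⇒pos ε (ℚ.1/ B)}}
    eq : B ℚ.* (ε ℚ.* (ℚ.1/ B)) ≡ ε
    eq = ≡.trans (≡.sym (ℚP.*-assoc B ε _)) (≡.trans (≡.cong (ℚ._* (ℚ.1/ B)) (ℚP.*-comm B ε))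
           (≡.trans (ℚP.*-assoc ε B _) (≡.trans (≡.cong (ε ℚ.*_) (ℚP.*-inverseʳ B)) (ℚP.*-identityʳ ε))))

  0<1 : 0ℚ ℚ.< 1ℚ
  0<1 = ℚP.positive⁻¹ 1ℚ

-- A real absolute value is given by the strict upper cuts of its values:
-- the relation ∣ x ∣< ε (with ε rational) determines the real number ∣x∣.
-- Multiplicativity and definiteness are not needed to form completions.
record IsUltrametricSeminorm (R : CommutativeRing c ℓ) (∣_∣<_ : CommutativeRing.Carrier R → ℚ → Set r)
       : Set (c ⊔ ℓ ⊔ r) where
  open CommutativeRing R
  field
    resp        : ∀ {x y ε} → x ≈ y → ∣ x ∣< ε → ∣ y ∣< ε
    nonNegative : ∀ {x ε} → ∣ x ∣< ε → 0ℚ ℚ.< ε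
    finite      : ∀ x → ∃[ ε ] ∣ x ∣< ε
    upward      : ∀ {x ε δ} → ε ℚ.≤ δ → ∣ x ∣< ε → ∣ x ∣< δ
    rounded     : ∀ {x ε} → ∣ x ∣< ε → ∃[ δ ] δ ℚ.< ε × ∣ x ∣< δ
    zero-norm   : ∀ {ε} → 0ℚ ℚ.< ε → ∣ 0# ∣< ε
    neg-norm    : ∀ {x ε} → ∣ x ∣< ε → ∣ - x ∣< ε
    ultrametric : ∀ {x y ε} → ∣ x ∣< ε → ∣ y ∣< ε → ∣ x + y ∣< ε
    submult     : ∀ {x y ε δ} → ∣ x ∣< ε → ∣ y ∣< δ → ∣ x * y ∣< (ε ℚ.* δ)

record SeminormedRing (c ℓ r : Level) : Set (lsuc (c ⊔ ℓ ⊔ r)) where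
  field
    commutativeRing : CommutativeRing c ℓ
  open CommutativeRing commutativeRing public
  infix 4 ∣_∣<_
  field
    ∣_∣<_      : Carrier → ℚ → Set r
    isSeminorm : IsUltrametricSeminorm commutativeRing ∣_∣<_
  open IsUltrametricSeminorm isSeminorm public

  infix 4 _⟶_
  _⟶_ : (ℕ → Carrier) → Carrier → Set r
  s ⟶ L = ∀ ε → 0ℚ ℚ.< ε → ∃[ N ] ∀ n → N ℕ.≤ n → ∣ s n - L ∣< ε

module UltrametricLemmas (A : SeminormedRing c ℓ r) where
  open SeminormedRing A
  open Relation.Binary.Reasoning.Setoid setoid
  open Algebra.Properties.Ring ring
    using (-‿distribˡ-*; -‿distribʳ-*; -‿+-comm; -‿involutive; -0#≈0#)
  open Algebra.Properties.CommutativeSemigroup +-commutativeSemigroup using (interchange)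

  sub-self : ∀ x → x - x ≈ 0#
  sub-self = -‿inverseʳ

  sub-zero : ∀ x → x - 0# ≈ x
  sub-zero x = trans (+-congˡ -0#≈0#) (+-identityʳ x)

  sub-add : ∀ x y → (x - y) + y ≈ x
  sub-add x y = trans (+-assoc _ _ _) (trans (+-congˡ (-‿inverseˡ y)) (+-identityʳ x))

  telescope : ∀ x y z → (x - y) + (y - z) ≈ x - z
  telescope x y z = trans (sym (+-assoc _ _ _)) (+-congʳ (sub-add x y))

  neg-sub : ∀ x y → - (x - y) ≈ y - x
  neg-sub x y = trans (sym (-‿+-comm x (- y))) (trans (+-congˡ (-‿involutive y)) (+-comm _ _))

  +-sub : ∀ x y x′ y′ → (x - x′) + (y - y′) ≈ (x + y) - (x′ + y′)
  +-sub x y x′ y′ = trans (interchange _ _ _ _) (+-congˡ (-‿+-comm x′ y′))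

  neg-neg-sub : ∀ x y → - (x - y) ≈ - x - - y
  neg-neg-sub x y = sym (-‿+-comm x (- y))

  *-sub : ∀ x y x′ y′ → x * (y - y′) + (x - x′) * y′ ≈ x * y - x′ * y′
  *-sub x y x′ y′ = begin
    x * (y - y′) + (x - x′) * y′              ≈⟨ +-cong (distribˡ x y (- y′)) (distribʳ y′ x (- x′)) ⟩
    (x * y + x * - y′) + (x * y′ + - x′ * y′) ≈⟨ +-cong (+-congˡ (sym (-‿distribʳ-* x y′))) (+-congˡ (sym (-‿distribˡ-* x′ y′))) ⟩
    (x * y - x * y′) + (x * y′ - x′ * y′)     ≈⟨ telescope _ _ _ ⟩
    x * y - x′ * y′                           ∎

  dist-sym : ∀ {x y ε} → ∣ x - y ∣< ε → ∣ y - x ∣< ε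
  dist-sym d = resp (neg-sub _ _) (neg-norm d)

  dist-trans : ∀ {x y z ε} → ∣ x - y ∣< ε → ∣ y - z ∣< ε → ∣ x - z ∣< ε
  dist-trans d e = resp (telescope _ _ _) (ultrametric d e)

  dist-≈ : ∀ {x y ε} → 0ℚ ℚ.< ε → x ≈ y → ∣ x - y ∣< ε
  dist-≈ ε>0 x≈y = resp (sym (trans (+-congʳ x≈y) (sub-self _))) (zero-norm ε>0)

  dist-+ : ∀ {x y x′ y′ ε} → ∣ x - x′ ∣< ε → ∣ y - y′ ∣< ε → ∣ (x + y) - (x′ + y′) ∣< ε
  dist-+ d e = resp (+-sub _ _ _ _) (ultrametric d e)

  -- ∣x∣ < B, ∣y′∣ < B′, ∣y − y′∣ < ε/B and ∣x − x′∣ < ε/B′ give ∣xy − x′y′∣ < ε.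
  dist-* : ∀ {x y x′ y′ B B′ δ δ′ ε} → ∣ x ∣< B → ∣ y′ ∣< B′ → B ℚ.* δ ≡ ε → B′ ℚ.* δ′ ≡ ε →
           ∣ y - y′ ∣< δ → ∣ x - x′ ∣< δ′ → ∣ x * y - x′ * y′ ∣< ε
  dist-* {B′ = B′} {δ′ = δ′} bx by′ eq eq′ dy dx = resp (*-sub _ _ _ _)
    (ultrametric (≡.subst (∣ _ ∣<_) eq (submult bx dy))
                 (≡.subst (∣ _ ∣<_) (≡.trans (ℚP.*-comm δ′ B′) eq′) (submult dx by′)))

  ball-move : ∀ {x y ε} → ∣ x ∣< ε → ∣ y - x ∣< ε → ∣ y ∣< ε
  ball-move bx d = resp (sub-add _ _) (ultrametric d bx)

-- The completion: Cauchy sequences, two of them being equal when their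
-- difference is a null sequence.
module Completion (A : SeminormedRing c ℓ r) where
  private module A = SeminormedRing A
  open A using (∣_∣<_)
  open UltrametricLemmas A

  record Cauchy : Set (c ⊔ r) where
    constructor mkCauchy
    field
      seq    : ℕ → A.Carrier
      cauchy : ∀ ε → 0ℚ ℚ.< ε → ∃[ N ] ∀ m n → N ℕ.≤ m → N ℕ.≤ n → ∣ seq m A.- seq n ∣< ε
  open Cauchy public

  infix 4 _≃_
  _≃_ : Cauchy → Cauchy → Set r
  x ≃ y = ∀ ε → 0ℚ ℚ.< ε → ∃[ N ] ∀ n → N ℕ.≤ n → ∣ seq x n A.- seq y n ∣< ε

  const : A.Carrier → Cauchy
  const a = mkCauchy (λ _ → a) λ ε ε>0 → 0 , λ _ _ _ _ → dist-≈ ε>0 A.refl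

  bounded : ∀ x → ∃₂ λ B N → ∀ n → N ℕ.≤ n → ∣ seq x n ∣< B
  bounded x with cauchy x 1ℚ 0<1
  ... | N , d with A.finite (seq x N)
  ... | e , xN<e = 1ℚ ℚ.⊔ e , N , λ n N≤n →
    ball-move (A.upward (ℚP.p≤q⊔p 1ℚ e) xN<e) (A.upward (ℚP.p≤p⊔q 1ℚ e) (d n N N≤n ℕP.≤-refl))

  private
    bounded⁺ : ∀ x → ∃₂ λ B N → 0ℚ ℚ.< B × (∀ n → N ℕ.≤ n → ∣ seq x n ∣< B)
    bounded⁺ x with bounded x
    ... | B , N , b = B , N , A.nonNegative (b N ℕP.≤-refl) , b

    ⊔ˡ : ∀ {a b n} → a ℕ.⊔ b ℕ.≤ n → a ℕ.≤ n
    ⊔ˡ = ℕP.m⊔n≤o⇒m≤o _ _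
    ⊔ʳ : ∀ {a b n} → a ℕ.⊔ b ℕ.≤ n → b ℕ.≤ n
    ⊔ʳ = ℕP.m⊔n≤o⇒n≤o _ _

  infixl 6 _+_
  _+_ : Cauchy → Cauchy → Cauchy
  x + y = mkCauchy (λ n → seq x n A.+ seq y n) go
    where
    go : ∀ ε → 0ℚ ℚ.< ε → ∃[ N ] ∀ m n → N ℕ.≤ m → N ℕ.≤ n →
         ∣ (seq x m A.+ seq y m) A.- (seq x n A.+ seq y n) ∣< ε
    go ε ε>0 with cauchy x ε ε>0 | cauchy y ε ε>0
    ... | N , d | M , e = N ℕ.⊔ M , λ m n p q → dist-+ (d m n (⊔ˡ p) (⊔ˡ q)) (e m n (⊔ʳ p) (⊔ʳ q))

  infix 8 -_
  -_ : Cauchy → Cauchy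
  - x = mkCauchy (λ n → A.- seq x n) λ ε ε>0 →
    let N , d = cauchy x ε ε>0 in N , λ m n p q → A.resp (neg-neg-sub _ _) (A.neg-norm (d m n p q))

  infixl 7 _*_
  _*_ : Cauchy → Cauchy → Cauchy
  x * y = mkCauchy (λ n → seq x n A.* seq y n) go
    where
    go : ∀ ε → 0ℚ ℚ.< ε → ∃[ N ] ∀ m n → N ℕ.≤ m → N ℕ.≤ n →
         ∣ seq x m A.* seq y m A.- seq x n A.* seq y n ∣< ε
    go ε ε>0 with bounded⁺ x | bounded⁺ y
    ... | B , N , B>0 , bx | B′ , N′ , B′>0 , by with ∃δ ε>0 B>0 | ∃δ ε>0 B′>0
    ... | δ , δ>0 , eq | δ′ , δ′>0 , eq′ with cauchy y δ δ>0 | cauchy x δ′ δ′>0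
    ... | M , dy | M′ , dx = (N ℕ.⊔ N′) ℕ.⊔ (M ℕ.⊔ M′) , λ m n p q →
      dist-* (bx m (⊔ˡ {N} {N′} (⊔ˡ p))) (by n (⊔ʳ {N} {N′} (⊔ˡ q))) eq eq′
             (dy m n (⊔ˡ {M} {M′} (⊔ʳ {N ℕ.⊔ N′} p)) (⊔ˡ {M} {M′} (⊔ʳ {N ℕ.⊔ N′} q)))
             (dx m n (⊔ʳ {M} {M′} (⊔ʳ {N ℕ.⊔ N′} p)) (⊔ʳ {M} {M′} (⊔ʳ {N ℕ.⊔ N′} q)))

  private
    pointwise : ∀ {x y} → (∀ n → seq x n A.≈ seq y n) → x ≃ y
    pointwise eq ε ε>0 = 0 , λ n _ → dist-≈ ε>0 (eq n)

    ≃-sym : ∀ {x y} → x ≃ y → y ≃ x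
    ≃-sym h ε ε>0 = let N , d = h ε ε>0 in N , λ n p → dist-sym (d n p)

    ≃-trans : ∀ {x y z} → x ≃ y → y ≃ z → x ≃ z
    ≃-trans h k ε ε>0 with h ε ε>0 | k ε ε>0
    ... | N , d | M , e = N ℕ.⊔ M , λ n p → dist-trans (d n (⊔ˡ p)) (e n (⊔ʳ p))

    +-cong : ∀ {x x′ y y′} → x ≃ x′ → y ≃ y′ → x + y ≃ x′ + y′
    +-cong h k ε ε>0 with h ε ε>0 | k ε ε>0
    ... | N , d | M , e = N ℕ.⊔ M , λ n p → dist-+ (d n (⊔ˡ p)) (e n (⊔ʳ p))

    neg-cong : ∀ {x x′} → x ≃ x′ → - x ≃ - x′
    neg-cong h ε ε>0 = let N , d = h ε ε>0 in N , λ n p → A.resp (neg-neg-sub _ _) (A.neg-norm (d n p))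

    *-cong : ∀ {x x′ y y′} → x ≃ x′ → y ≃ y′ → x * y ≃ x′ * y′
    *-cong {x} {x′} {y} {y′} h k ε ε>0 with bounded⁺ x | bounded⁺ y′
    ... | B , N , B>0 , bx | B′ , N′ , B′>0 , by with ∃δ ε>0 B>0 | ∃δ ε>0 B′>0
    ... | δ , δ>0 , eq | δ′ , δ′>0 , eq′ with k δ δ>0 | h δ′ δ′>0
    ... | M , dy | M′ , dx = (N ℕ.⊔ N′) ℕ.⊔ (M ℕ.⊔ M′) , λ n p →
      dist-* (bx n (⊔ˡ {N} {N′} (⊔ˡ p))) (by n (⊔ʳ {N} {N′} (⊔ˡ p))) eq eq′
             (dy n (⊔ˡ {M} {M′} (⊔ʳ {N ℕ.⊔ N′} p))) (dx n (⊔ʳ {M} {M′} (⊔ʳ {N ℕ.⊔ N′} p)))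

  isCommutativeRing : IsCommutativeRing _≃_ _+_ _*_ -_ (const A.0#) (const A.1#)
  isCommutativeRing = record
    { isRing = record
      { +-isAbelianGroup = record
        { isGroup = record
          { isMonoid = record
            { isSemigroup = record
              { isMagma = record
                { isEquivalence = record
                  { refl  = λ {x} → pointwise {x} {x} λ _ → A.refl
                  ; sym   = λ {x y} → ≃-sym {x} {y}
                  ; trans = λ {x y z} → ≃-trans {x} {y} {z}
                  }
                ; ∙-cong = λ {x x′ y y′} → +-cong {x} {x′} {y} {y′}
                }
              ; assoc = λ x y z → pointwise {(x + y) + z} {x + (y + z)} λ _ → A.+-assoc _ _ _
              }
            ; identity = (λ x → pointwise {const A.0# + x} {x} λ _ → A.+-identityˡ _)
                       , (λ x → pointwise {x + const A.0#} {x} λ _ → A.+-identityʳ _)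
            }
          ; inverse = (λ x → pointwise {(- x) + x} {const A.0#} λ _ → A.-‿inverseˡ _)
                    , (λ x → pointwise {x + (- x)} {const A.0#} λ _ → A.-‿inverseʳ _)
          ; ⁻¹-cong = λ {x x′} → neg-cong {x} {x′}
          }
        ; comm = λ x y → pointwise {x + y} {y + x} λ _ → A.+-comm _ _
        }
      ; *-cong = λ {x x′ y y′} → *-cong {x} {x′} {y} {y′}
      ; *-assoc = λ x y z → pointwise {(x * y) * z} {x * (y * z)} λ _ → A.*-assoc _ _ _
      ; *-identity = (λ x → pointwise {const A.1# * x} {x} λ _ → A.*-identityˡ _)
                   , (λ x → pointwise {x * const A.1#} {x} λ _ → A.*-identityʳ _)
      ; distrib = (λ x y z → pointwise {x * (y + z)} {x * y + x * z} λ _ → A.distribˡ _ _ _)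
                , (λ x y z → pointwise {(y + z) * x} {y * x + z * x} λ _ → A.distribʳ _ _ _)
      }
    ; *-comm = λ x y → pointwise {x * y} {y * x} λ _ → A.*-comm _ _
    }

  -- ∣lim xₙ∣ < ε iff some δ < ε eventually bounds all ∣xₙ∣ strictly.
  norm< : Cauchy → ℚ → Set r
  norm< x ε = ∃[ δ ] δ ℚ.< ε × ∃[ N ] ∀ n → N ℕ.≤ n → ∣ seq x n ∣< δ

  completion : SeminormedRing (c ⊔ r) r r
  completion = record
    { commutativeRing = record { isCommutativeRing = isCommutativeRing }
    ; ∣_∣<_ = norm<
    ; isSeminorm = record
      { resp = λ {x} {y} → nresp {x} {y}
      ; nonNegative = λ (δ , δ<ε , N , b) → ℚP.<-trans (A.nonNegative (b N ℕP.≤-refl)) δ<ε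
      ; finite = λ x → let B , N , b = bounded x in
          B ℚ.+ 1ℚ , B , ≡.subst (ℚ._< B ℚ.+ 1ℚ) (ℚP.+-identityʳ B) (ℚP.+-monoʳ-< B 0<1) , N , b
      ; upward = λ ε≤ε′ (δ , δ<ε , b) → δ , ℚP.<-≤-trans δ<ε ε≤ε′ , b
      ; rounded = λ (δ , δ<ε , b) → let m , δ<m , m<ε = ℚP.<-dense δ<ε in m , m<ε , δ , δ<m , b
      ; zero-norm = λ ε>0 → let m , 0<m , m<ε = ℚP.<-dense ε>0 in
          m , m<ε , 0 , λ _ _ → A.zero-norm 0<m
      ; neg-norm = λ (δ , δ<ε , N , b) → δ , δ<ε , N , λ n p → A.neg-norm (b n p)
      ; ultrametric = λ {x} {y} → nultra {x} {y}
      ; submult = λ {x} {y} → nsub {x} {y}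
      }
    }
    where
    nresp : ∀ {x y ε} → x ≃ y → norm< x ε → norm< y ε
    nresp {x} {y} h (δ , δ<ε , N , b) with h δ (A.nonNegative (b N ℕP.≤-refl))
    ... | M , d = δ , δ<ε , N ℕ.⊔ M , λ n p → ball-move (b n (⊔ˡ p)) (dist-sym (d n (⊔ʳ p)))
    nultra : ∀ {x y ε} → norm< x ε → norm< y ε → norm< (x + y) ε
    nultra (δ , δ<ε , N , b) (δ′ , δ′<ε , N′ , b′) =
      δ ℚ.⊔ δ′ , ⊔-< , N ℕ.⊔ N′ , λ n p →
        A.ultrametric (A.upward (ℚP.p≤p⊔q δ δ′) (b n (⊔ˡ p))) (A.upward (ℚP.p≤q⊔p δ δ′) (b′ n (⊔ʳ p)))
      where
      ⊔-< : δ ℚ.⊔ δ′ ℚ.< _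
      ⊔-< with ℚP.⊔-sel δ δ′
      ... | inj₁ e = ≡.subst (ℚ._< _) (≡.sym e) δ<ε
      ... | inj₂ e = ≡.subst (ℚ._< _) (≡.sym e) δ′<ε
    nsub : ∀ {x y ε δ} → norm< x ε → norm< y δ → norm< (x * y) (ε ℚ.* δ)
    nsub {ε = ε} {δ} (α , α<ε , N , b) (β , β<δ , N′ , b′) =
      α ℚ.* β , lt , N ℕ.⊔ N′ , λ n p → A.submult (b n (⊔ˡ p)) (b′ n (⊔ʳ p))
      where
      α>0 : 0ℚ ℚ.< α
      α>0 = A.nonNegative (b N ℕP.≤-refl)
      δ>0 : 0ℚ ℚ.< δ
      δ>0 = ℚP.<-trans (A.nonNegative (b′ N′ ℕP.≤-refl)) β<δ
      lt : α ℚ.* β ℚ.< ε ℚ.* δ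
      lt = ℚP.<-trans (ℚP.*-monoʳ-<-pos α {{ℚ.positive α>0}} β<δ)
                      (ℚP.*-monoˡ-<-pos δ {{ℚ.positive δ>0}} α<ε)

  module Ĉ = SeminormedRing completion

  const-norm : ∀ {a ε} → ∣ a ∣< ε → norm< (const a) ε
  const-norm b = let δ , δ<ε , b′ = A.rounded b in δ , δ<ε , 0 , λ _ _ → b′

  const-isRingHomomorphism : RingMorphisms.IsRingHomomorphism A.rawRing Ĉ.rawRing const
  const-isRingHomomorphism = record
    { isSemiringHomomorphism = record
      { isNearSemiringHomomorphism = record
        { +-isMonoidHomomorphism = record
          { isMagmaHomomorphism = record
            { isRelHomomorphism = record { cong = λ {a} {b} eq → pointwise {const a} {const b} λ _ → eq }
            ; homo = λ a b → Ĉ.refl {const (a A.+ b)} }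
          ; ε-homo = Ĉ.refl {const A.0#} }
        ; *-homo = λ a b → Ĉ.refl {const (a A.* b)} }
      ; 1#-homo = Ĉ.refl {const A.1#} }
    ; -‿homo = λ a → Ĉ.refl {const (A.- a)} }

int : ℤ → ℚ
int n = ℚ.mkℚ n 0 (Coprime.sym (Coprime.1-coprimeTo _))

nat : ℕ → ℚ
nat n = int (+ n)

module IntEmbedding where
  toᵘ : ∀ n → ℚ.toℚᵘ (int n) ℚᵘ.≃ ℚᵘ.mkℚᵘ n 0
  toᵘ n = ℚᵘ.*≡* ≡.refl

  int-+ : ∀ a b → int (a ℤ.+ b) ≡ int a ℚ.+ int b
  int-+ a b = ℚP.toℚᵘ-injective (ℚᵘP.≃-trans (toᵘ (a ℤ.+ b)) (ℚᵘP.≃-trans eq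
    (ℚᵘP.≃-sym (ℚᵘP.≃-trans (ℚP.toℚᵘ-homo-+ (int a) (int b)) (ℚᵘP.+-cong (toᵘ a) (toᵘ b))))))
    where
    eq : ℚᵘ.mkℚᵘ (a ℤ.+ b) 0 ℚᵘ.≃ ℚᵘ.mkℚᵘ a 0 ℚᵘ.+ ℚᵘ.mkℚᵘ b 0
    eq = ℚᵘ.*≡* (≡.cong (ℤ._* (+ 1)) (≡.sym (≡.cong₂ ℤ._+_ (ℤP.*-identityʳ a) (ℤP.*-identityʳ b))))

  int-* : ∀ a b → int (a ℤ.* b) ≡ int a ℚ.* int b
  int-* a b = ℚP.toℚᵘ-injective (ℚᵘP.≃-trans (toᵘ (a ℤ.* b)) (ℚᵘP.≃-trans (ℚᵘ.*≡* ≡.refl)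
    (ℚᵘP.≃-sym (ℚᵘP.≃-trans (ℚP.toℚᵘ-homo-* (int a) (int b)) (ℚᵘP.*-cong (toᵘ a) (toᵘ b))))))

  int-neg : ∀ a → int (ℤ.- a) ≡ ℚ.- int a
  int-neg a = ℚP.toℚᵘ-injective (ℚᵘP.≃-trans (toᵘ (ℤ.- a)) (ℚᵘP.≃-sym
    (ℚᵘP.≃-trans (ℚP.toℚᵘ-homo‿- (int a)) (ℚᵘP.-‿cong (toᵘ a)))))

  int-< : ∀ {a b} → a ℤ.< b → int a ℚ.< int b
  int-< {a} {b} a<b = ℚP.toℚᵘ-cancel-< (ℚᵘP.<-respˡ-≃ (ℚᵘP.≃-sym (toᵘ a)) (ℚᵘP.<-respʳ-≃ (ℚᵘP.≃-sym (toᵘ b))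
    (ℚᵘ.*<* (≡.subst₂ ℤ._<_ (≡.sym (ℤP.*-identityʳ a)) (≡.sym (ℤP.*-identityʳ b)) a<b))))

  nat-< : ∀ {a b} → a ℕ.< b → nat a ℚ.< nat b
  nat-< a<b = int-< (ℤ.+<+ a<b)

  nat-+ : ∀ a b → nat (a ℕ.+ b) ≡ nat a ℚ.+ nat b
  nat-+ a b = int-+ (+ a) (+ b)

  nat-* : ∀ a b → nat (a ℕ.* b) ≡ nat a ℚ.* nat b
  nat-* a b = ≡.trans (≡.cong int (ℤP.pos-* a b)) (int-* (+ a) (+ b))

  clear-denominator : ∀ x → x ℚ.* nat (ℚ.↧ₙ x) ≡ int (ℚ.↥ x)
  clear-denominator x@record{} = ℚP.toℚᵘ-injective (ℚᵘP.≃-trans (ℚP.toℚᵘ-homo-* x (nat (ℚ.↧ₙ x)))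
    (ℚᵘP.≃-trans (ℚᵘP.*-congˡ {ℚ.toℚᵘ x} (toᵘ (ℚ.↧ x))) (ℚᵘP.≃-trans eq (ℚᵘP.≃-sym (toᵘ (ℚ.↥ x))))))
    where
    eq : ℚ.toℚᵘ x ℚᵘ.* ℚᵘ.mkℚᵘ (ℚ.↧ x) 0 ℚᵘ.≃ ℚᵘ.mkℚᵘ (ℚ.↥ x) 0
    eq = ℚᵘ.*≡* (≡.trans (ℤP.*-identityʳ _) (≡.cong (ℚ.↥ x ℤ.*_)
           (≡.cong +_ (≡.sym (ℕP.*-identityʳ _)))))

module Padic (p : ℕ) (p-prime : Prime p) where
  open IntEmbedding

  private
    P : ℕ → ℚ
    P k = nat (p ℕ.^ k)

    instance
      p≢0 : ℕ.NonZero p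
      p≢0 = prime⇒nonZero p-prime
      p>1 : ℕ.NonTrivial p
      p>1 = prime⇒nonTrivial p-prime

    P>0 : ∀ k → 0ℚ ℚ.< P k
    P>0 k = nat-< {0} {p ℕ.^ k} (ℕ.>-nonZero⁻¹ (p ℕ.^ k) {{ℕP.m^n≢0 p k}})

    posP : ∀ k → ℚ.Positive (P k)
    posP k = ℚ.positive (P>0 k)

    P-+ : ∀ i j → P (i ℕ.+ j) ≡ P i ℚ.* P j
    P-+ i j = ≡.trans (≡.cong nat (ℕP.^-distribˡ-+-* p i j)) (nat-* (p ℕ.^ i) (p ℕ.^ j))

    cancelP : ∀ k {x y} → x ℚ.* P k ≡ y ℚ.* P k → x ≡ y
    cancelP k eq = ℚP.≤-antisym (ℚP.*-cancelʳ-≤-pos (P k) {{posP k}} (ℚP.≤-reflexive eq))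
                                (ℚP.*-cancelʳ-≤-pos (P k) {{posP k}} (ℚP.≤-reflexive (≡.sym eq)))

  -- x = a p^i / (b p^j) with p ∤ b, i.e. ∣x∣ₚ ≤ p^(j−i), and p^(j−i) < ε.
  infix 4 ∣_∣ₚ<_
  record ∣_∣ₚ<_ (x ε : ℚ) : Set where
    constructor mkBound
    field
      i j   : ℕ
      a     : ℤ
      b     : ℕ
      p∤b   : p ∤ b
      x≡    : x ℚ.* (nat b ℚ.* nat (p ℕ.^ j)) ≡ int a ℚ.* nat (p ℕ.^ i)
      small : nat (p ℕ.^ j) ℚ.< ε ℚ.* nat (p ℕ.^ i)

  private
    open +-*-Solver

    p∤1 : p ∤ 1
    p∤1 p∣1 = ℕ.nonTrivial⇒≢1 {p} (Div.∣1⇒≡1 p∣1)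

    p∤* : ∀ {b b′} → p ∤ b → p ∤ b′ → p ∤ b ℕ.* b′
    p∤* {b} {b′} h h′ d with euclidsLemma b b′ p-prime d
    ... | inj₁ e = h e
    ... | inj₂ e = h′ e

    n<p^n : ∀ n → n ℕ.< p ℕ.^ n
    n<p^n zero = ℕ.s≤s ℕ.z≤n
    n<p^n (suc n) = ℕP.≤-<-trans (n<p^n n) (ℕP.^-monoʳ-< p (ℕ.nonTrivial⇒n>1 p) (ℕP.n<1+n n))

    split : ∀ d → .{{ℕ.NonZero d}} → ∃₂ λ j b → p ∤ b × d ≡ b ℕ.* p ℕ.^ j
    split = <-rec (λ d → .{{ℕ.NonZero d}} → ∃₂ λ j b → p ∤ b × d ≡ b ℕ.* p ℕ.^ j) go
      where
      go : ∀ d → (∀ {e} → e ℕ.< d → .{{ℕ.NonZero e}} → ∃₂ λ j b → p ∤ b × e ≡ b ℕ.* p ℕ.^ j) →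
           .{{ℕ.NonZero d}} → ∃₂ λ j b → p ∤ b × d ≡ b ℕ.* p ℕ.^ j
      go d rec with p Div.∣? d
      ... | no p∤d = 0 , d , p∤d , ≡.sym (ℕP.*-identityʳ d)
      ... | yes p∣d = let j , b , p∤b , eq = rec {Div.quotient p∣d} (Div.quotient-< p∣d) {{Div.quotient≢0 p∣d}} in
        suc j , b , p∤b , ≡.trans (Div.m∣n⇒n≡quotient*m p∣d) (≡.trans (≡.cong (ℕ._* p) eq)
          (≡.trans (ℕP.*-assoc b _ p) (≡.cong (b ℕ.*_) (ℕP.*-comm _ p))))

    nonneg : ∀ {x ε} → ∣ x ∣ₚ< ε → 0ℚ ℚ.< ε
    nonneg {x} {ε} (mkBound i j _ _ _ _ small) =
      ℚP.*-cancelʳ-<-nonNeg (P i) {{ℚP.pos⇒nonNeg (P i) {{posP i}}}} {0ℚ} {ε}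
        (≡.subst (ℚ._< ε ℚ.* P i) (≡.sym (ℚP.*-zeroˡ (P i))) (ℚP.<-trans (P>0 j) small))

    fin : ∀ x → ∃[ ε ] ∣ x ∣ₚ< ε
    fin x with split (ℚ.↧ₙ x)
    ... | j , b , p∤b , eq = P j ℚ.+ 1ℚ , mkBound 0 j (ℚ.↥ x) b p∤b
      (≡.trans (≡.cong (x ℚ.*_) (≡.trans (≡.sym (nat-* b (p ℕ.^ j))) (≡.cong nat (≡.sym eq))))
        (≡.trans (clear-denominator x) (≡.sym (ℚP.*-identityʳ _))))
      (≡.subst₂ ℚ._<_ (ℚP.+-identityʳ (P j)) (≡.sym (ℚP.*-identityʳ _)) (ℚP.+-monoʳ-< (P j) 0<1))

    up : ∀ {x ε δ} → ε ℚ.≤ δ → ∣ x ∣ₚ< ε → ∣ x ∣ₚ< δ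
    up {ε = ε} {δ} ε≤δ (mkBound i j a b p∤b x≡ small) = mkBound i j a b p∤b x≡
      (ℚP.<-≤-trans small (ℚP.*-monoʳ-≤-nonNeg (P i) {{ℚP.pos⇒nonNeg (P i) {{posP i}}}} {ε} {δ} ε≤δ))

    round : ∀ {x ε} → ∣ x ∣ₚ< ε → ∃[ δ ] δ ℚ.< ε × ∣ x ∣ₚ< δ
    round {x} {ε} (mkBound i j a b p∤b x≡ small) with ∃δ {P j} {P i} (P>0 j) (P>0 i)
    ... | q , _ , eq with ℚP.<-dense {q} {ε} (ℚP.*-cancelˡ-<-nonNeg (P i) {{ℚP.pos⇒nonNeg (P i) {{posP i}}}} {q} {ε}
                            (≡.subst₂ ℚ._<_ (≡.sym eq) (ℚP.*-comm ε (P i)) small))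
    ... | m , q<m , m<ε = m , m<ε , mkBound i j a b p∤b x≡
      (≡.subst (ℚ._< m ℚ.* P i) (≡.trans (ℚP.*-comm q (P i)) eq) (ℚP.*-monoˡ-<-pos (P i) {{posP i}} {q} {m} q<m))

    zer : ∀ {ε} → 0ℚ ℚ.< ε → ∣ 0ℚ ∣ₚ< ε
    zer {ε} ε>0 = mkBound d 0 (+ 0) 1 p∤1
      (≡.trans (ℚP.*-zeroˡ (nat 1 ℚ.* P 0)) (≡.sym (ℚP.*-zeroˡ (P d))))
      (ℚP.≤-<-trans
        (≡.subst (P 0 ℚ.≤_) (≡.sym (clear-denominator ε)) num≥1)
        (ℚP.*-monoʳ-<-pos ε {{ℚ.positive ε>0}} {nat d} {P d} (nat-< {d} {p ℕ.^ d} (n<p^n d))))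
      where
      d : ℕ
      d = ℚ.↧ₙ ε
      num≥1 : P 0 ℚ.≤ int (ℚ.↥ ε)
      num≥1 = lemma ε (ℚ.positive ε>0)
        where
        lemma : ∀ q → ℚ.Positive q → P 0 ℚ.≤ int (ℚ.↥ q)
        lemma (ℚ.mkℚ (ℤ.+[1+ zero ]) _ _) _ = ℚP.≤-refl
        lemma (ℚ.mkℚ (ℤ.+[1+ suc n ]) _ _) _ = ℚP.<⇒≤ (nat-< {1} {suc (suc n)} (ℕ.s≤s (ℕ.s≤s ℕ.z≤n)))

    ng : ∀ {x ε} → ∣ x ∣ₚ< ε → ∣ ℚ.- x ∣ₚ< ε
    ng {x} (mkBound i j a b p∤b x≡ small) = mkBound i j (ℤ.- a) b p∤b
      (≡.trans (≡.sym (ℚP.neg-distribˡ-* x _)) (≡.trans (≡.cong ℚ.-_ x≡)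
        (≡.trans (ℚP.neg-distribˡ-* (int a) (P i)) (≡.cong (ℚ._* P i) (≡.sym (int-neg a)))))) small

    ultra≤ : ∀ {x y ε} (h : ∣ x ∣ₚ< ε) (k : ∣ y ∣ₚ< ε) →
             ∣_∣ₚ<_.j k ℕ.+ ∣_∣ₚ<_.i h ℕ.≤ ∣_∣ₚ<_.i k ℕ.+ ∣_∣ₚ<_.j h → ∣ x ℚ.+ y ∣ₚ< ε
    ultra≤ {x} {y} (mkBound i j a b p∤b x≡ small) (mkBound i′ j′ a′ b′ p∤b′ y≡ _) le =
      mkBound i j (a ℤ.* + b′ ℤ.+ a′ ℤ.* + (b ℕ.* p ℕ.^ m)) (b ℕ.* b′) (p∤* p∤b p∤b′) main small
      where
      open ≡.≡-Reasoning
      m : ℕ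
      m = (i′ ℕ.+ j) ∸ (j′ ℕ.+ i)
      exps : P i′ ℚ.* P j ≡ P m ℚ.* (P j′ ℚ.* P i)
      exps = begin
        P i′ ℚ.* P j             ≡⟨ P-+ i′ j ⟨
        P (i′ ℕ.+ j)             ≡⟨ ≡.cong P (ℕP.m∸n+n≡m le) ⟨
        P (m ℕ.+ (j′ ℕ.+ i))     ≡⟨ P-+ m _ ⟩
        P m ℚ.* P (j′ ℕ.+ i)     ≡⟨ ≡.cong (P m ℚ.*_) (P-+ j′ i) ⟩
        P m ℚ.* (P j′ ℚ.* P i)   ∎
      y≡′ : y ℚ.* (nat b′ ℚ.* P j) ≡ int a′ ℚ.* (P m ℚ.* P i)
      y≡′ = cancelP j′ (begin
        y ℚ.* (nat b′ ℚ.* P j) ℚ.* P j′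
          ≡⟨ solve 4 (λ y b s t → y :* (b :* s) :* t := (y :* (b :* t)) :* s) ≡.refl y (nat b′) (P j) (P j′) ⟩
        y ℚ.* (nat b′ ℚ.* P j′) ℚ.* P j
          ≡⟨ ≡.cong (ℚ._* P j) y≡ ⟩
        int a′ ℚ.* P i′ ℚ.* P j
          ≡⟨ ℚP.*-assoc (int a′) (P i′) (P j) ⟩
        int a′ ℚ.* (P i′ ℚ.* P j)
          ≡⟨ ≡.cong (int a′ ℚ.*_) exps ⟩
        int a′ ℚ.* (P m ℚ.* (P j′ ℚ.* P i))
          ≡⟨ solve 4 (λ a m t i → a :* (m :* (t :* i)) := a :* (m :* i) :* t) ≡.refl (int a′) (P m) (P j′) (P i) ⟩
        int a′ ℚ.* (P m ℚ.* P i) ℚ.* P j′ ∎)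
      num : int (a ℤ.* + b′ ℤ.+ a′ ℤ.* + (b ℕ.* p ℕ.^ m)) ≡ int a ℚ.* nat b′ ℚ.+ int a′ ℚ.* (nat b ℚ.* P m)
      num = ≡.trans (int-+ (a ℤ.* + b′) (a′ ℤ.* + (b ℕ.* p ℕ.^ m))) (≡.cong₂ ℚ._+_ (int-* a (+ b′))
              (≡.trans (int-* a′ (+ (b ℕ.* p ℕ.^ m))) (≡.cong (int a′ ℚ.*_) (nat-* b (p ℕ.^ m)))))
      main : (x ℚ.+ y) ℚ.* (nat (b ℕ.* b′) ℚ.* P j) ≡ int (a ℤ.* + b′ ℤ.+ a′ ℤ.* + (b ℕ.* p ℕ.^ m)) ℚ.* P i
      main = begin
        (x ℚ.+ y) ℚ.* (nat (b ℕ.* b′) ℚ.* P j)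
          ≡⟨ ≡.cong (λ z → (x ℚ.+ y) ℚ.* (z ℚ.* P j)) (nat-* b b′) ⟩
        (x ℚ.+ y) ℚ.* (nat b ℚ.* nat b′ ℚ.* P j)
          ≡⟨ solve 5 (λ x y b b′ s → (x :+ y) :* (b :* b′ :* s) := (x :* (b :* s)) :* b′ :+ (y :* (b′ :* s)) :* b)
               ≡.refl x y (nat b) (nat b′) (P j) ⟩
        x ℚ.* (nat b ℚ.* P j) ℚ.* nat b′ ℚ.+ y ℚ.* (nat b′ ℚ.* P j) ℚ.* nat b
          ≡⟨ ≡.cong₂ (λ u v → u ℚ.* nat b′ ℚ.+ v ℚ.* nat b) x≡ y≡′ ⟩
        int a ℚ.* P i ℚ.* nat b′ ℚ.+ int a′ ℚ.* (P m ℚ.* P i) ℚ.* nat b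
          ≡⟨ solve 6 (λ a i b′ a′ m b → a :* i :* b′ :+ a′ :* (m :* i) :* b := (a :* b′ :+ a′ :* (b :* m)) :* i)
               ≡.refl (int a) (P i) (nat b′) (int a′) (P m) (nat b) ⟩
        (int a ℚ.* nat b′ ℚ.+ int a′ ℚ.* (nat b ℚ.* P m)) ℚ.* P i
          ≡⟨ ≡.cong (ℚ._* P i) num ⟨
        int (a ℤ.* + b′ ℤ.+ a′ ℤ.* + (b ℕ.* p ℕ.^ m)) ℚ.* P i ∎

    ultra : ∀ {x y ε} → ∣ x ∣ₚ< ε → ∣ y ∣ₚ< ε → ∣ x ℚ.+ y ∣ₚ< ε
    ultra {x} {y} {ε} h k with ℕP.≤-total (∣_∣ₚ<_.j k ℕ.+ ∣_∣ₚ<_.i h) (∣_∣ₚ<_.i k ℕ.+ ∣_∣ₚ<_.j h)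
    ... | inj₁ le = ultra≤ h k le
    ... | inj₂ ge = ≡.subst (λ z → ∣ z ∣ₚ< ε) (ℚP.+-comm y x)
      (ultra≤ k h (≡.subst₂ ℕ._≤_ (ℕP.+-comm (∣_∣ₚ<_.i k) _) (ℕP.+-comm (∣_∣ₚ<_.j k) _) ge))

    mult : ∀ {x y ε δ} → ∣ x ∣ₚ< ε → ∣ y ∣ₚ< δ → ∣ x ℚ.* y ∣ₚ< (ε ℚ.* δ)
    mult {x} {y} {ε} {δ} h@(mkBound i j a b p∤b x≡ small) (mkBound i′ j′ a′ b′ p∤b′ y≡ small′) =
      mkBound (i ℕ.+ i′) (j ℕ.+ j′) (a ℤ.* a′) (b ℕ.* b′) (p∤* p∤b p∤b′) main lt
      where
      open ≡.≡-Reasoning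
      main : x ℚ.* y ℚ.* (nat (b ℕ.* b′) ℚ.* P (j ℕ.+ j′)) ≡ int (a ℤ.* a′) ℚ.* P (i ℕ.+ i′)
      main = begin
        x ℚ.* y ℚ.* (nat (b ℕ.* b′) ℚ.* P (j ℕ.+ j′))
          ≡⟨ ≡.cong₂ (λ u v → x ℚ.* y ℚ.* (u ℚ.* v)) (nat-* b b′) (P-+ j j′) ⟩
        x ℚ.* y ℚ.* (nat b ℚ.* nat b′ ℚ.* (P j ℚ.* P j′))
          ≡⟨ solve 6 (λ x y b b′ s t → x :* y :* (b :* b′ :* (s :* t)) := x :* (b :* s) :* (y :* (b′ :* t)))
               ≡.refl x y (nat b) (nat b′) (P j) (P j′) ⟩
        x ℚ.* (nat b ℚ.* P j) ℚ.* (y ℚ.* (nat b′ ℚ.* P j′))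
          ≡⟨ ≡.cong₂ ℚ._*_ x≡ y≡ ⟩
        int a ℚ.* P i ℚ.* (int a′ ℚ.* P i′)
          ≡⟨ solve 4 (λ a s a′ t → a :* s :* (a′ :* t) := a :* a′ :* (s :* t)) ≡.refl (int a) (P i) (int a′) (P i′) ⟩
        int a ℚ.* int a′ ℚ.* (P i ℚ.* P i′)
          ≡⟨ ≡.cong₂ ℚ._*_ (int-* a a′) (P-+ i i′) ⟨
        int (a ℤ.* a′) ℚ.* P (i ℕ.+ i′) ∎
      rhs : ε ℚ.* P i ℚ.* (δ ℚ.* P i′) ≡ ε ℚ.* δ ℚ.* P (i ℕ.+ i′)
      rhs = ≡.trans (solve 4 (λ e s d t → e :* s :* (d :* t) := e :* d :* (s :* t)) ≡.refl ε (P i) δ (P i′))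
              (≡.cong (ε ℚ.* δ ℚ.*_) (≡.sym (P-+ i i′)))
      lt : P (j ℕ.+ j′) ℚ.< ε ℚ.* δ ℚ.* P (i ℕ.+ i′)
      lt = ≡.subst₂ ℚ._<_ (≡.sym (P-+ j j′)) rhs
        (ℚP.<-trans (ℚP.*-monoʳ-<-pos (P j) {{posP j}} {P j′} {δ ℚ.* P i′} small′)
          (ℚP.*-monoˡ-<-pos (δ ℚ.* P i′) {{ℚ.positive (ℚP.<-trans (P>0 j′) small′)}} {P j} {ε ℚ.* P i} small))

  ℚ-padic : SeminormedRing 0ℓ 0ℓ 0ℓ
  ℚ-padic = record
    { commutativeRing = ℚP.+-*-commutativeRing
    ; ∣_∣<_ = ∣_∣ₚ<_
    ; isSeminorm = record
      { resp = λ { ≡.refl h → h }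
      ; nonNegative = nonneg
      ; finite = fin
      ; upward = up
      ; rounded = round
      ; zero-norm = zer
      ; neg-norm = ng
      ; ultrametric = ultra
      ; submult = mult
      }
    }

  nat-integral : ∀ n {ε} → 1ℚ ℚ.< ε → ∣ nat n ∣ₚ< ε
  nat-integral n {ε} 1<ε = mkBound 0 0 (+ n) 1 p∤1 ≡.refl (≡.subst (1ℚ ℚ.<_) (≡.sym (ℚP.*-identityʳ ε)) 1<ε)

  module ℚ̂ = Completion ℚ-padic

  ℚₚ-ring : SeminormedRing 0ℓ 0ℓ 0ℓ
  ℚₚ-ring = ℚ̂.completion

  module ℚₚ = SeminormedRing ℚₚ-ring

  record ℤₚ : Set where
    constructor mkℤₚ
    field
      value    : ℚₚ.Carrier
      integral : ∀ {ε} → 1ℚ ℚ.< ε → ℚₚ.∣ value ∣< ε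
  open ℤₚ public

  ℕ→ℤₚ : ℕ → ℤₚ
  ℕ→ℤₚ n = mkℤₚ (ℚ̂.const (nat n)) λ {ε} 1<ε → ℚ̂.const-norm {nat n} {ε} (nat-integral n 1<ε)

-- Polynomials are coefficient lists, constant term first.
module Polynomials (R : CommutativeRing c ℓ) where
  open CommutativeRing R

  Polynomial : Set c
  Polynomial = List Carrier

  eval : Polynomial → Carrier → Carrier
  eval []      x = 0#
  eval (a ∷ q) x = a + x * eval q x

  -- x^ n
  infix 9 x^_
  x^_ : ℕ → Polynomial
  x^ n = replicate n 0# ++ 1# ∷ []

  -- monic as = a₀ + a₁ x + … + aₙ₋₁ xⁿ⁻¹ + xⁿ
  monic : List Carrier → Polynomial
  monic as = as ++ 1# ∷ []

-- An algebraic closure of ℚ_p with the (unique) extension of the p-adic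
-- absolute value. `multiplicative` is the inequality ∣x∣∣y∣ ≤ ∣xy∣ in terms of
-- cuts; the converse inequality is part of `isSeminorm`.
record AlgebraicClosure (p : ℕ) (p-prime : Prime p) (c ℓ₁ ℓ₂ r : Level) : Set (lsuc (c ⊔ ℓ₁ ⊔ ℓ₂ ⊔ r)) where
  open Padic p p-prime using (module ℚₚ)
  field
    field′ : HeytingField c ℓ₁ ℓ₂
  open HeytingField field′ public
  commutativeRing : CommutativeRing c ℓ₁
  commutativeRing = HeytingCommutativeRing.commutativeRing heytingCommutativeRing
  open Polynomials commutativeRing using (eval; monic)
  field
    ι                    : ℚₚ.Carrier → Carrier
    ι-isRingHomomorphism : RingMorphisms.IsRingHomomorphism ℚₚ.rawRing (CommutativeRing.rawRing commutativeRing) ι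
    algebraic            : ∀ x → ∃[ as ] eval (monic (map ι as)) x ≈ 0#
    algebraicallyClosed  : ∀ a as → ∃[ x ] eval (monic (a ∷ as)) x ≈ 0#
  infix 4 ∣_∣<_
  field
    ∣_∣<_          : Carrier → ℚ → Set r
    isSeminorm     : IsUltrametricSeminorm commutativeRing ∣_∣<_
    definite       : ∀ {x} → (∀ {ε} → 0ℚ ℚ.< ε → ∣ x ∣< ε) → x ≈ 0#
    multiplicative : ∀ {x y ε} → ∣ x * y ∣< ε → ∃₂ λ α β → ∣ x ∣< α × ∣ y ∣< β × α ℚ.* β ℚ.≤ ε
    extends        : ∀ {x ε} → ℚₚ.∣ x ∣< ε ⇔ ∣ ι x ∣< ε

  seminormedRing : SeminormedRing c ℓ₁ r
  seminormedRing = record { commutativeRing = commutativeRing ; ∣_∣<_ = ∣_∣<_ ; isSeminorm = isSeminorm }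

module PowerSeries (R : CommutativeRing c ℓ) where
  open CommutativeRing R
  open Algebra.Definitions _≈_ using (Invertible)
  open Algebra.Properties.Semiring.Sum semiring using (sum⁺-syntax)

  Series : Set c
  Series = ℕ → Carrier

  infix 4 _≋_
  _≋_ : Series → Series → Set ℓ
  f ≋ g = ∀ n → f n ≈ g n

  infixl 6 _⊕_
  _⊕_ : Series → Series → Series
  (f ⊕ g) n = f n + g n

  infixl 7 _⊛_
  _⊛_ : Series → Series → Series
  (f ⊛ g) n = ∑[ k ≤ n ] (f (toℕ k) * g (n ∸ toℕ k))

  constant : Carrier → Series
  constant a zero    = a
  constant a (suc _) = 0#

  -- Long division by a series with invertible constant term: with
  -- h₀ = f₀ / g₀, f / g = h₀ + t · (((f − h₀ g) / t) / g).
  quotient : (f g : Series) → Invertible 1# _*_ (g 0) → Series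
  quotient f g (u , _)     zero    = u * f 0
  quotient f g g₀⁻¹@(u , _) (suc n) = quotient (λ k → f (suc k) - u * f 0 * g (suc k)) g g₀⁻¹ n

  quotient-⊛ : ∀ f g (g₀⁻¹ : Invertible 1# _*_ (g 0)) → quotient f g g₀⁻¹ ⊛ g ≋ f
  quotient-⊛ f g (u , ug₀≈1 , _) zero = begin
    u * f 0 * g 0 + 0#  ≈⟨ +-identityʳ _ ⟩
    u * f 0 * g 0       ≈⟨ *-congʳ (*-comm u (f 0)) ⟩
    f 0 * u * g 0       ≈⟨ *-assoc _ _ _ ⟩
    f 0 * (u * g 0)     ≈⟨ *-congˡ ug₀≈1 ⟩
    f 0 * 1#            ≈⟨ *-identityʳ _ ⟩
    f 0                 ∎
    where open Relation.Binary.Reasoning.Setoid setoid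
  quotient-⊛ f g g₀⁻¹@(u , _) (suc n) = begin
    h₀g + (quotient rest g g₀⁻¹ ⊛ g) n ≈⟨ +-congˡ (quotient-⊛ rest g g₀⁻¹ n) ⟩
    h₀g + (f (suc n) - h₀g)            ≈⟨ +-comm _ _ ⟩
    f (suc n) - h₀g + h₀g              ≈⟨ +-assoc _ _ _ ⟩
    f (suc n) + (- h₀g + h₀g)          ≈⟨ +-congˡ (-‿inverseˡ _) ⟩
    f (suc n) + 0#                     ≈⟨ +-identityʳ _ ⟩
    f (suc n)                          ∎
    where
    open Relation.Binary.Reasoning.Setoid setoid
    h₀g : Carrier
    h₀g = u * f 0 * g (suc n)
    rest : Series
    rest k = f (suc k) - u * f 0 * g (suc k)

-- Continuity of maps X → B, for X a subset of A given by its inclusion.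
module Continuity {a ℓa ra b ℓb rb s : Level} {X : Set s}
                  (A : SeminormedRing a ℓa ra) (incl : X → SeminormedRing.Carrier A)
                  (B : SeminormedRing b ℓb rb) where
  private module A = SeminormedRing A
  open SeminormedRing B
  open UltrametricLemmas B
  open Polynomials commutativeRing using (Polynomial; eval)

  Continuous : (X → Carrier) → Set (s ⊔ ra ⊔ rb)
  Continuous f = ∀ u ε → 0ℚ ℚ.< ε → ∃[ δ ] 0ℚ ℚ.< δ ×
                   (∀ w → A.∣ incl u A.- incl w ∣< δ → ∣ f u - f w ∣< ε)

  private
    ⊓>0 : ∀ {δ δ′} → 0ℚ ℚ.< δ → 0ℚ ℚ.< δ′ → 0ℚ ℚ.< δ ℚ.⊓ δ′
    ⊓>0 {δ} {δ′} h h′ with ℚP.⊓-sel δ δ′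
    ... | inj₁ e = ≡.subst (0ℚ ℚ.<_) (≡.sym e) h
    ... | inj₂ e = ≡.subst (0ℚ ℚ.<_) (≡.sym e) h′

    ⊓ˡ : ∀ {x} δ δ′ → A.∣ x ∣< (δ ℚ.⊓ δ′) → A.∣ x ∣< δ
    ⊓ˡ δ δ′ = A.upward (ℚP.p⊓q≤p δ δ′)
    ⊓ʳ : ∀ {x} δ δ′ → A.∣ x ∣< (δ ℚ.⊓ δ′) → A.∣ x ∣< δ′
    ⊓ʳ δ δ′ = A.upward (ℚP.p⊓q≤q δ δ′)

  continuous-const : ∀ y → Continuous (λ _ → y)
  continuous-const y u ε ε>0 = 1ℚ , 0<1 , λ _ _ → dist-≈ ε>0 refl

  continuous-+ : ∀ {f g} → Continuous f → Continuous g → Continuous (λ u → f u + g u)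
  continuous-+ cf cg u ε ε>0 with cf u ε ε>0 | cg u ε ε>0
  ... | δ , δ>0 , df | δ′ , δ′>0 , dg = δ ℚ.⊓ δ′ , ⊓>0 δ>0 δ′>0 , λ w d →
    dist-+ (df w (⊓ˡ δ δ′ d)) (dg w (⊓ʳ δ δ′ d))

  continuous-* : ∀ {f g} → Continuous f → Continuous g → Continuous (λ u → f u * g u)
  continuous-* {f} {g} cf cg u ε ε>0 with finite (f u) | finite (g u)
  ... | B₁ , fu<B₁ | B₂ , gu<B₂ with ∃δ ε>0 (nonNegative fu<B₁) | ∃δ ε>0 (nonNegative gu<B₂)
  ... | η , η>0 , eq | η′ , η′>0 , eq′ with cg u η η>0 | cf u η′ η′>0 | cg u B₂ (nonNegative gu<B₂)
  ... | δ , δ>0 , dg | δ′ , δ′>0 , df | δ″ , δ″>0 , dB =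
    δ ℚ.⊓ (δ′ ℚ.⊓ δ″) , ⊓>0 δ>0 (⊓>0 δ′>0 δ″>0) , λ w d →
      let d′ = ⊓ʳ δ (δ′ ℚ.⊓ δ″) d in
      dist-* fu<B₁ (ball-move gu<B₂ (dist-sym (dB w (⊓ʳ δ′ δ″ d′)))) eq eq′
             (dg w (⊓ˡ δ (δ′ ℚ.⊓ δ″) d)) (df w (⊓ˡ δ′ δ″ d′))

  continuous-eval : ∀ {f} → Continuous f → ∀ q → Continuous (λ u → eval q (f u))
  continuous-eval cf []      = continuous-const 0#
  continuous-eval cf (a ∷ q) = continuous-+ (continuous-const a) (continuous-* cf (continuous-eval cf q))

module HalfInverse (R : CommutativeRing c ℓ) (η : ℚ → CommutativeRing.Carrier R)
                   (η-hom : RingMorphisms.IsRingHomomorphism (CommutativeRing.rawRing ℚP.+-*-commutativeRing) (CommutativeRing.rawRing R) η) where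
  open CommutativeRing R
  open RingMorphisms.IsRingHomomorphism η-hom
  open Relation.Binary.Reasoning.Setoid setoid

  half-inverse : η ½ * (1# * η 1ℚ + 1#) ≈ 1#
  half-inverse = begin
    η ½ * (1# * η 1ℚ + 1#)  ≈⟨ *-congˡ (+-cong (*-identityˡ _) (sym 1#-homo)) ⟩
    η ½ * (η 1ℚ + η 1ℚ)     ≈⟨ *-congˡ (+-homo 1ℚ 1ℚ) ⟨
    η ½ * η (1ℚ ℚ.+ 1ℚ)     ≈⟨ *-homo ½ (1ℚ ℚ.+ 1ℚ) ⟨
    η 1ℚ                    ≈⟨ 1#-homo ⟩
    1#                      ∎

  two-invertible : Algebra.Definitions.Invertible _≈_ 1# _*_ (1# * η 1ℚ + 1#)
  two-invertible = η ½ , half-inverse , trans (*-comm _ _) half-inverse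

module Fermionic (p : ℕ) (p-prime : Prime p) (K : AlgebraicClosure p p-prime c ℓ₁ ℓ₂ r) where
  open Padic p p-prime public
  private
    module K = AlgebraicClosure K
    module K̂ = Completion K.seminormedRing

  ℂₚ-ring : SeminormedRing (c ⊔ r) r r
  ℂₚ-ring = K̂.completion

  module ℂₚ = SeminormedRing ℂₚ-ring
  open ℂₚ

  ℚₚ→ℂₚ : ℚₚ.Carrier → Carrier
  ℚₚ→ℂₚ x = K̂.const (K.ι x)

  ℚ→ℂₚ : ℚ → Carrier
  ℚ→ℂₚ x = ℚₚ→ℂₚ (ℚ̂.const x)

  ℤₚ→ℂₚ : ℤₚ → Carrier
  ℤₚ→ℂₚ u = ℚₚ→ℂₚ (value u)

  ℚₚ→ℂₚ-isRingHomomorphism : RingMorphisms.IsRingHomomorphism ℚₚ.rawRing rawRing ℚₚ→ℂₚ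
  ℚₚ→ℂₚ-isRingHomomorphism =
    Composition.isRingHomomorphism (λ {x y z} → trans {x} {y} {z}) K.ι-isRingHomomorphism K̂.const-isRingHomomorphism

  ℚ→ℂₚ-isRingHomomorphism : RingMorphisms.IsRingHomomorphism (CommutativeRing.rawRing ℚP.+-*-commutativeRing) rawRing ℚ→ℂₚ
  ℚ→ℂₚ-isRingHomomorphism =
    Composition.isRingHomomorphism (λ {x y z} → trans {x} {y} {z}) ℚ̂.const-isRingHomomorphism ℚₚ→ℂₚ-isRingHomomorphism

  open Continuity ℚₚ-ring value ℂₚ-ring

  record ContinuousMap : Set (c ⊔ r) where
    constructor mkContinuous
    field
      to         : ℤₚ → Carrier
      continuous : Continuous to
  open ContinuousMap public

  open Polynomials commutativeRing public
  open PowerSeries commutativeRing public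
  open Algebra.Properties.Semiring.Sum semiring using (sum-syntax)
  open Algebra.Properties.Semiring.Mult semiring using () renaming (_×_ to _·_)
  open Algebra.Properties.Semiring.Exp semiring using (_^_)
  open Algebra.Definitions _≈_ using (Invertible)

  ℚₚ→ℂₚ-isometric : ∀ {x ε} → ℚₚ.∣ x ∣< ε → ∣ ℚₚ→ℂₚ x ∣< ε
  ℚₚ→ℂₚ-isometric {x} {ε} h = K̂.const-norm {K.ι x} {ε} (Equivalence.to K.extends h)

  inclusion-continuous : Continuous ℤₚ→ℂₚ
  inclusion-continuous u ε ε>0 = ε , ε>0 , λ w d →
    resp {ℚₚ→ℂₚ (value u ℚₚ.- value w)} {ℤₚ→ℂₚ u - ℤₚ→ℂₚ w} {ε} (homo-sub u w)
         (ℚₚ→ℂₚ-isometric {value u ℚₚ.- value w} {ε} d)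
    where
    module H = RingMorphisms.IsRingHomomorphism ℚₚ→ℂₚ-isRingHomomorphism
    homo-sub : ∀ u w → ℚₚ→ℂₚ (value u ℚₚ.- value w) ≈ ℤₚ→ℂₚ u - ℤₚ→ℂₚ w
    homo-sub u w = trans {ℚₚ→ℂₚ (value u ℚₚ.- value w)} {ℤₚ→ℂₚ u + ℚₚ→ℂₚ (ℚₚ.- value w)} {ℤₚ→ℂₚ u - ℤₚ→ℂₚ w}
      (H.+-homo (value u) (ℚₚ.- value w))
      (+-congˡ {ℤₚ→ℂₚ u} {ℚₚ→ℂₚ (ℚₚ.- value w)} { - ℤₚ→ℂₚ w} (H.-‿homo (value w)))

  polynomialMap : Polynomial → ContinuousMap
  polynomialMap q = mkContinuous (λ u → eval q (ℤₚ→ℂₚ u)) (continuous-eval inclusion-continuous q)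

  partialSum : ContinuousMap → ℕ → Carrier
  partialSum f N = ∑[ x < p ℕ.^ N ] (to f (ℕ→ℤₚ (toℕ x)) * (- 1#) ^ toℕ x)

  -- The integral of f against μ₋₁ exists and equals L.
  infix 4 ∫_dμ₋₁≈_
  ∫_dμ₋₁≈_ : ContinuousMap → Carrier → Set r
  ∫ f dμ₋₁≈ L = partialSum f ⟶ L

  1/_! : ℕ → Carrier
  1/ k ! = ℚ→ℂₚ (((+ 1) ℚ./ (k !)) {{k ℕP.!≢0}})

  -- egf a = Σₖ aₖ tᵏ / k!; for aₖ = ∫ yᵏ dμ₋₁(y) this is the series ∫ eʸᵗ dμ₋₁(y).
  egf : (ℕ → Carrier) → Series
  egf a k = a k * 1/ k !

  -- For f = Σₖ cₖ tᵏ = Σₖ (k! cₖ) tᵏ / k!, ⟨ f ∣ xᵏ ⟩ = k! cₖ.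
  ⟨_∣_⟩ : Series → Polynomial → Carrier
  ⟨ f ∣ q ⟩ = ∑[ k < length q ] (lookup q k * ((toℕ k !) · f (toℕ k)))

  eᵗ : Series
  eᵗ = egf (λ _ → 1#)

  2# : Carrier
  2# = 1# + 1#

  eᵗ+1 : Series
  eᵗ+1 = eᵗ ⊕ constant 1#

  eᵗ+1-invertible : Invertible 1# _*_ (eᵗ+1 0)
  eᵗ+1-invertible = HalfInverse.two-invertible commutativeRing ℚ→ℂₚ ℚ→ℂₚ-isRingHomomorphism

  2/eᵗ+1 : Series
  2/eᵗ+1 = quotient (constant 2#) eᵗ+1 eᵗ+1-invertible

  IsEulerSequence : (ℕ → Carrier) → Set r
  IsEulerSequence E = 2/eᵗ+1 ≋ egf E

{-# OPTIONS --safe #-}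
module Submission where

-- Let Sₙ,ₖ = Σ_{x<n} (−1)ˣ xᵏ with n odd. Since eˣᵗ (eᵗ + 1) = eˣᵗ + e⁽ˣ⁺¹⁾ᵗ, the
-- alternating sum telescopes: (Σₖ Sₙ,ₖ tᵏ/k!) (eᵗ + 1) = 1 + eⁿᵗ. For n = pᴺ the
-- right-hand side tends to 2 coefficientwise, because n → 0 p-adically. The
-- coefficients of a quotient by a series with invertible constant term depend
-- continuously on those of the dividend, so Sₙ,ₖ/k! tends to the k-th
-- coefficient of 2/(eᵗ + 1). Everything else follows by linearity and
-- uniqueness of limits.

open import Defs
open import Level using (Level)
open import Algebra.Bundles using (CommutativeRing)
open import Algebra.Morphism.Structures using (module RingMorphisms)
import Algebra.Definitions
import Algebra.Properties.CommutativeSemiring.Binomial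
import Algebra.Properties.Ring
import Algebra.Properties.Semiring.Exp
import Algebra.Properties.Semiring.Mult
import Algebra.Properties.Semiring.Sum
import Algebra.Solver.Ring.NaturalCoefficients.Default
import Relation.Binary.Reasoning.Setoid
open import Data.Fin.Base as Fin using (Fin; toℕ)
import Data.Fin.Properties as FinP
open import Data.Integer.Base using (+_)
import Data.Integer.Properties as ℤP
open import Data.List.Base using ([]; _∷_; length; lookup)
open import Data.Nat.Base as ℕ using (ℕ; zero; suc; _∸_; _!)
open import Data.Nat.Combinatorics using (_C_; nCk≡n!/k![n-k]!; k![n∸k]!∣n!)
open import Data.Nat.Divisibility as Div using (_∤_)
open import Data.Nat.Primality using (Prime; prime[2]; prime⇒nonZero; prime⇒nonTrivial; euclidsLemma)
import Data.Nat.DivMod as DivMod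
import Data.Nat.Properties as ℕP
open import Data.Product.Base using (_×_; ∃; _,_; proj₁; proj₂)
open import Data.Rational.Base as ℚ using (ℚ; 0ℚ; 1ℚ)
import Data.Rational.Properties as ℚP
import Data.Rational.Unnormalised.Base as ℚᵘ
import Data.Rational.Unnormalised.Properties as ℚᵘP
open import Data.Sum.Base using (inj₁; inj₂)
open import Relation.Nullary using (contradiction)
open import Relation.Binary.PropositionalEquality as ≡ using (_≡_)

private
  variable
    c ℓ r : Level

-- Limits in an ultrametric seminormed ring.

module Limits (A : SeminormedRing c ℓ r) where
  open SeminormedRing A
  open UltrametricLemmas A
  open PowerSeries commutativeRing
  open Algebra.Definitions _≈_ using (Invertible)
  open Algebra.Properties.Semiring.Exp semiring using (_^_)
  open Algebra.Properties.Semiring.Mult semiring using () renaming (_×_ to _·_)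
  open Algebra.Properties.Semiring.Sum semiring using (sum)
  open Relation.Binary.Reasoning.Setoid setoid

  ⟶-cong : ∀ {s t L M} → (∀ n → s n ≈ t n) → L ≈ M → s ⟶ L → t ⟶ M
  ⟶-cong s≈t L≈M s⟶L ε ε>0 = let N , d = s⟶L ε ε>0 in
    N , λ n N≤n → resp (+-cong (s≈t n) (-‿cong L≈M)) (d n N≤n)

  ⟶-const : ∀ a → (λ _ → a) ⟶ a
  ⟶-const a ε ε>0 = 0 , λ _ _ → dist-≈ ε>0 refl

  ⟶-+ : ∀ {s t L M} → s ⟶ L → t ⟶ M → (λ n → s n + t n) ⟶ L + M
  ⟶-+ s⟶L t⟶M ε ε>0 = let N , d = s⟶L ε ε>0 ; N′ , d′ = t⟶M ε ε>0 in
    N ℕ.⊔ N′ , λ n N≤n → dist-+ (d n (ℕP.m⊔n≤o⇒m≤o N N′ N≤n)) (d′ n (ℕP.m⊔n≤o⇒n≤o N N′ N≤n))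

  ⟶-neg : ∀ {s L} → s ⟶ L → (λ n → - s n) ⟶ - L
  ⟶-neg s⟶L ε ε>0 = let N , d = s⟶L ε ε>0 in
    N , λ n N≤n → resp (neg-neg-sub _ _) (neg-norm (d n N≤n))

  -- Rests on sₙ tₙ - L M = sₙ (tₙ - M) + (sₙ - L) M: the tolerance ε is divided by a bound for ∣sₙ∣
  -- and by a bound for ∣M∣.
  ⟶-* : ∀ {s t L M} → s ⟶ L → t ⟶ M → (λ n → s n * t n) ⟶ L * M
  ⟶-* {s} {t} {L} {M} s⟶L t⟶M ε ε>0 with finite L | finite M
  ... | B , L<B | B′ , M<B′ with ∃/ (nonNegative L<B) | ∃/ (nonNegative M<B′)
    where
    ∃/ : ∀ {B} → 0ℚ ℚ.< B → ∃ λ δ → 0ℚ ℚ.< δ × B ℚ.* δ ≡ ε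
    ∃/ {B} B>0 = ε ℚ.* (ℚ.1/ B)
      , ℚP.positive⁻¹ _ {{ℚP.pos*pos⇒pos ε {{ℚ.positive ε>0}} (ℚ.1/ B) {{ℚP.1/pos⇒pos B}}}}
      , ≡.trans (≡.cong (B ℚ.*_) (ℚP.*-comm ε _)) (≡.trans (≡.sym (ℚP.*-assoc B _ ε))
          (≡.trans (≡.cong (ℚ._* ε) (ℚP.*-inverseʳ B)) (ℚP.*-identityˡ ε)))
      where
      instance
        posB : ℚ.Positive B
        posB = ℚ.positive B>0
        B≢0 : ℚ.NonZero B
        B≢0 = ℚP.pos⇒nonZero B
  ... | δ , δ>0 , Bδ≡ε | δ′ , δ′>0 , B′δ′≡ε
    -- Tolerance `B` is enough here: by the ultrametric inequality, ∣L∣ < B and ∣sₙ - L∣ < B already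
    -- give ∣sₙ∣ < B.
    with s⟶L B (nonNegative L<B) | t⟶M δ δ>0 | s⟶L δ′ δ′>0
  ... | N , bound | N′ , dt | N″ , ds = N ℕ.⊔ (N′ ℕ.⊔ N″) , λ n N≤n →
    let N′⊔N″≤n = ℕP.m⊔n≤o⇒n≤o N (N′ ℕ.⊔ N″) N≤n in
    dist-* (ball-move L<B (bound n (ℕP.m⊔n≤o⇒m≤o N (N′ ℕ.⊔ N″) N≤n))) M<B′ Bδ≡ε B′δ′≡ε
           (dt n (ℕP.m⊔n≤o⇒m≤o N′ N″ N′⊔N″≤n)) (ds n (ℕP.m⊔n≤o⇒n≤o N′ N″ N′⊔N″≤n))

  ⟶-^ : ∀ {s L} → s ⟶ L → ∀ k → (λ n → s n ^ k) ⟶ L ^ k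
  ⟶-^ s⟶L zero    = ⟶-const 1#
  ⟶-^ s⟶L (suc k) = ⟶-* s⟶L (⟶-^ s⟶L k)

  ⟶-· : ∀ k {s L} → s ⟶ L → (λ n → k · s n) ⟶ k · L
  ⟶-· zero    s⟶L = ⟶-const 0#
  ⟶-· (suc k) s⟶L = ⟶-+ s⟶L (⟶-· k s⟶L)

  ⟶-sum : ∀ {m} {s : ℕ → Fin m → Carrier} {L : Fin m → Carrier} →
          (∀ i → (λ n → s n i) ⟶ L i) → (λ n → sum (s n)) ⟶ sum L
  ⟶-sum {zero}  lim = ⟶-const 0#
  ⟶-sum {suc m} lim = ⟶-+ (lim Fin.zero) (⟶-sum (λ i → lim (Fin.suc i)))

  -- A seminorm determines limits only up to elements of seminorm 0, so definiteness enters as a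
  -- hypothesis; it is applied to L - M.
  ⟶-unique : (∀ {x} → (∀ {ε} → 0ℚ ℚ.< ε → ∣ x ∣< ε) → x ≈ 0#) →
             ∀ {s L M} → s ⟶ L → s ⟶ M → L ≈ M
  ⟶-unique definite {s} {L} {M} s⟶L s⟶M = begin
    L            ≈⟨ sub-add L M ⟨
    L - M + M    ≈⟨ +-congʳ (definite close) ⟩
    0# + M       ≈⟨ +-identityˡ M ⟩
    M            ∎
    where
    close : ∀ {ε} → 0ℚ ℚ.< ε → ∣ L - M ∣< ε
    close {ε} ε>0 = let N , d = s⟶L ε ε>0 ; N′ , d′ = s⟶M ε ε>0 in
      dist-trans (dist-sym (d (N ℕ.⊔ N′) (ℕP.m≤m⊔n N N′))) (d′ (N ℕ.⊔ N′) (ℕP.m≤n⊔m N N′))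

  -- The recursion is that of long division: the limit of the leading coefficient
  -- is h₀ / g₀, and the tails satisfy the same hypothesis with the next remainder.
  module _ (g : Series) (g₀⁻¹ : Invertible 1# _*_ (g 0)) where
    private
      u = proj₁ g₀⁻¹

    ⟶-quotient₀ : ∀ {F : ℕ → Series} {h : Series} → (λ n → (F n ⊛ g) 0) ⟶ h 0 → (λ n → F n 0) ⟶ u * h 0
    ⟶-quotient₀ {F} lim = ⟶-cong cancel refl (⟶-* (⟶-const u) lim)
      where
      cancel : ∀ n → u * (F n 0 * g 0 + 0#) ≈ F n 0
      cancel n = begin
        u * (F n 0 * g 0 + 0#)  ≈⟨ *-congˡ (trans (+-identityʳ _) (*-comm _ _)) ⟩
        u * (g 0 * F n 0)       ≈⟨ *-assoc _ _ _ ⟨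
        u * g 0 * F n 0         ≈⟨ *-congʳ (proj₁ (proj₂ g₀⁻¹)) ⟩
        1# * F n 0              ≈⟨ *-identityˡ _ ⟩
        F n 0                   ∎

    ⟶-quotient : ∀ {F : ℕ → Series} {h : Series} → (∀ k → (λ n → (F n ⊛ g) k) ⟶ h k) →
                 ∀ k → (λ n → F n k) ⟶ quotient h g g₀⁻¹ k
    ⟶-quotient {F} {h} lim zero    = ⟶-quotient₀ {F} {h} (lim 0)
    ⟶-quotient {F} {h} lim (suc k) = ⟶-quotient {λ n j → F n (suc j)} tail-lim k
      where
      tail-lim : ∀ j → (λ n → ((λ i → F n (suc i)) ⊛ g) j) ⟶ h (suc j) - u * h 0 * g (suc j)
      tail-lim j = ⟶-cong
        -- By definition the coefficient `(F n ⊛ g) (suc j)` is `F n 0 * g (suc j)` plus the j-th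
        -- coefficient of the tail times `g`; subtracting the first term leaves the tail product.
        (λ n → trans (+-congʳ (+-comm _ _)) (trans (+-assoc _ _ _) (trans (+-congˡ (sub-self _)) (+-identityʳ _))))
        refl
        (⟶-+ (lim (suc j)) (⟶-neg (⟶-* (⟶-quotient₀ {F} {h} (lim 0)) (⟶-const (g (suc j))))))

-- Products of formal power series.

module PowerSeriesProperties (R : CommutativeRing c ℓ) where
  open CommutativeRing R
  open PowerSeries R
  open Algebra.Properties.Semiring.Sum semiring

  ⊛-constant : ∀ f a → f ⊛ constant a ≋ (λ n → f n * a)
  ⊛-constant f a zero    = +-identityʳ _
  ⊛-constant f a (suc n) = trans (+-cong (zeroʳ _) (⊛-constant (λ k → f (suc k)) a n)) (+-identityˡ _)

  ⊛-distribˡ : ∀ f g h → f ⊛ (g ⊕ h) ≋ (f ⊛ g) ⊕ (f ⊛ h)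
  ⊛-distribˡ f g h n = trans (sum-cong-≋ {suc n} λ k → distribˡ (f (toℕ k)) (g (n ∸ toℕ k)) (h (n ∸ toℕ k)))
    (∑-distrib-+ {suc n} (λ k → f (toℕ k) * g (n ∸ toℕ k)) (λ k → f (toℕ k) * h (n ∸ toℕ k)))

-- Linear functionals on polynomials.

module PolynomialPairing (R : CommutativeRing c ℓ) where
  open CommutativeRing R
  open Polynomials R
  open Algebra.Properties.Semiring.Exp semiring using (_^_)
  open Algebra.Properties.Semiring.Sum semiring
  open Relation.Binary.Reasoning.Setoid setoid

  -- The linear functional with xᵏ ↦ a k. Taking a k = k! fₖ yields `⟨ f ∣ q ⟩`, and a k = yᵏ yields
  -- evaluation at y, so both sides of the theorem become instances of one construction.
  pairing : Polynomial → (ℕ → Carrier) → Carrier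
  pairing q a = ∑[ k < length q ] (lookup q k * a (toℕ k))

  pairing-cong : ∀ q {a b} → (∀ k → a k ≈ b k) → pairing q a ≈ pairing q b
  pairing-cong q a≈b = sum-cong-≋ {length q} λ k → *-congˡ (a≈b (toℕ k))

  pairing-x^ : ∀ n a → pairing (x^ n) a ≈ a n
  pairing-x^ zero    a = trans (+-identityʳ _) (*-identityˡ _)
  pairing-x^ (suc n) a = trans (+-cong (zeroˡ _) (pairing-x^ n (λ k → a (suc k)))) (+-identityˡ _)

  -- Unfolds Horner's scheme: the factor y in front of the remaining polynomial raises each exponent
  -- by one, which matches the shift of the index.
  eval≈pairing : ∀ q y → eval q y ≈ pairing q (y ^_)
  eval≈pairing []      y = refl
  eval≈pairing (b ∷ q) y = +-cong (sym (*-identityʳ b)) (begin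
    y * eval q y                                          ≈⟨ *-congˡ (eval≈pairing q y) ⟩
    y * pairing q (y ^_)                                  ≈⟨ *-distribˡ-sum {length q} y (λ k → lookup q k * y ^ toℕ k) ⟩
    ∑[ k < length q ] (y * (lookup q k * y ^ toℕ k))      ≈⟨ sum-cong-≋ {length q} (λ k → swap (lookup q k) (y ^ toℕ k)) ⟩
    pairing q (λ k → y ^ suc k)                           ∎)
    where
    swap : ∀ a z → y * (a * z) ≈ a * (y * z)
    swap a z = trans (sym (*-assoc y a z)) (trans (*-congʳ (*-comm y a)) (*-assoc a y z))

-- Alternating sums and their telescoping.

module AlternatingSums (R : CommutativeRing c ℓ) where
  open CommutativeRing R
  open Polynomials R
  open PowerSeries R
  open PolynomialPairing R
  open Algebra.Properties.Ring ring using (-1*x≈-x; -‿involutive)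
  open Algebra.Properties.Semiring.Exp semiring using (_^_)
  open Algebra.Properties.Semiring.Sum semiring
  open Relation.Binary.Reasoning.Setoid setoid

  -- For n = pᴺ these are the sums whose limit is the fermionic integral.
  alternatingSum : ℕ → (ℕ → Carrier) → Carrier
  alternatingSum n a = ∑[ x < n ] (a (toℕ x) * (- 1#) ^ toℕ x)

  alternatingSum-cong : ∀ n {a b} → (∀ x → a x ≈ b x) → alternatingSum n a ≈ alternatingSum n b
  alternatingSum-cong n a≈b = sum-cong-≋ {n} λ x → *-congʳ (a≈b (toℕ x))

  alternatingSum-*ʳ : ∀ n a y → alternatingSum n a * y ≈ alternatingSum n (λ x → a x * y)
  alternatingSum-*ʳ n a y = trans (*-distribʳ-sum {n} y (λ x → a (toℕ x) * (- 1#) ^ toℕ x))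
    (sum-cong-≋ {n} λ x → trans (*-assoc _ _ _) (trans (*-congˡ (*-comm _ y)) (sym (*-assoc _ y _))))

  alternatingSum-sum : ∀ n {m} (a : Fin m → ℕ → Carrier) →
                       sum (λ i → alternatingSum n (a i)) ≈ alternatingSum n (λ x → sum (λ i → a i x))
  alternatingSum-sum n {m} a = trans (∑-comm {m} {n} λ i x → a i (toℕ x) * (- 1#) ^ toℕ x)
    (sum-cong-≋ {n} λ x → sym (*-distribʳ-sum {m} ((- 1#) ^ toℕ x) (λ i → a i (toℕ x))))

  -- The two occurrences of a (x + 1) carry opposite signs and cancel. Keeping the boundary term on
  -- the left lets the induction run through n of either parity: removing the first summand shifts
  -- `a` and flips all signs.
  alternatingSum-telescope : ∀ n a → alternatingSum n (λ x → a x + a (suc x)) + (- 1#) ^ n * a n ≈ a 0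
  alternatingSum-telescope zero    a = trans (+-identityˡ _) (*-identityˡ _)
  alternatingSum-telescope (suc n) a = begin
    (a 0 + a 1) * 1# + ∑[ x < n ] (b (suc (toℕ x)) * (- 1# * (- 1#) ^ toℕ x)) + - 1# * (- 1#) ^ n * a (suc n)
      ≈⟨ +-cong (+-cong (*-identityʳ _) (sum-cong-≋ {n} λ x → negate (b (suc (toℕ x))) _))
                (trans (*-assoc _ _ _) (*-comm _ _)) ⟩
    (a 0 + a 1) + ∑[ x < n ] ((b (suc (toℕ x)) * (- 1#) ^ toℕ x) * - 1#) + (- 1#) ^ n * a (suc n) * - 1#
      ≈⟨ +-congʳ (+-congˡ (*-distribʳ-sum {n} (- 1#) (λ x → b (suc (toℕ x)) * (- 1#) ^ toℕ x))) ⟨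
    (a 0 + a 1) + alternatingSum n (λ x → b (suc x)) * - 1# + (- 1#) ^ n * a (suc n) * - 1#
      ≈⟨ trans (+-assoc _ _ _) (+-congˡ (sym (distribʳ _ _ _))) ⟩
    (a 0 + a 1) + (alternatingSum n (λ x → b (suc x)) + (- 1#) ^ n * a (suc n)) * - 1#
      ≈⟨ +-congˡ (*-congʳ (alternatingSum-telescope n (λ x → a (suc x)))) ⟩
    (a 0 + a 1) + a 1 * - 1#
      ≈⟨ +-congˡ (trans (*-comm _ _) (-1*x≈-x (a 1))) ⟩
    (a 0 + a 1) - a 1
      ≈⟨ trans (+-assoc _ _ _) (trans (+-congˡ (-‿inverseʳ _)) (+-identityʳ _)) ⟩
    a 0 ∎
    where
    b : ℕ → Carrier
    b x = a x + a (suc x)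
    negate : ∀ y s → y * (- 1# * s) ≈ y * s * - 1#
    negate y s = trans (*-congˡ (*-comm _ _)) (sym (*-assoc _ _ _))

  -1^odd : ∀ n → 2 ∤ n → (- 1#) ^ n ≈ - 1#
  -1^odd zero          2∤n = contradiction (2 Div.∣0) 2∤n
  -1^odd (suc zero)    2∤n = *-identityʳ _
  -1^odd (suc (suc n)) 2∤n = begin
    - 1# * (- 1# * (- 1#) ^ n)  ≈⟨ *-congˡ (*-congˡ (-1^odd n λ 2∣n → 2∤n (Div.∣m∣n⇒∣m+n Div.∣-refl 2∣n))) ⟩
    - 1# * (- 1# * - 1#)        ≈⟨ *-congˡ (trans (-1*x≈-x _) (-‿involutive 1#)) ⟩
    - 1# * 1#                   ≈⟨ *-identityʳ _ ⟩
    - 1#                        ∎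

  -- Parity enters here: for odd n the boundary term is - a n and moves to the right with a plus
  -- sign, which is the source of the 2 in 2/(eᵗ + 1).
  alternatingSum-telescope-odd : ∀ n → 2 ∤ n → ∀ a → alternatingSum n (λ x → a x + a (suc x)) ≈ a 0 + a n
  alternatingSum-telescope-odd n 2∤n a = begin
    S                            ≈⟨ trans (+-congˡ (-‿inverseˡ _)) (+-identityʳ _) ⟨
    S + (- a n + a n)            ≈⟨ +-assoc _ _ _ ⟨
    S + - a n + a n              ≈⟨ +-congʳ (+-congˡ (trans (*-congʳ (-1^odd n 2∤n)) (-1*x≈-x _))) ⟨
    S + (- 1#) ^ n * a n + a n   ≈⟨ +-congʳ (alternatingSum-telescope n a) ⟩
    a 0 + a n                    ∎
    where
    S : Carrier
    S = alternatingSum n (λ x → a x + a (suc x))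

  -- Linearity in q, which reduces the integral of a polynomial to the integrals of the powers.
  alternatingSum-eval : ∀ q n (y : ℕ → Carrier) → alternatingSum n (λ x → eval q (y x)) ≈
                                  pairing q (λ k → alternatingSum n (λ x → y x ^ k))
  alternatingSum-eval q n y = begin
    alternatingSum n (λ x → eval q (y x))
      ≈⟨ alternatingSum-cong n (λ x → eval≈pairing q (y x)) ⟩
    alternatingSum n (λ x → sum {length q} (λ i → lookup q i * y x ^ toℕ i))
      ≈⟨ alternatingSum-sum n {length q} (λ i x → lookup q i * y x ^ toℕ i) ⟨
    sum {length q} (λ i → alternatingSum n (λ x → lookup q i * y x ^ toℕ i))
      ≈⟨ sum-cong-≋ {length q} (λ i → trans (sum-cong-≋ {n} λ x → *-assoc _ _ _)
           (sym (*-distribˡ-sum {n} (lookup q i) (λ x → y (toℕ x) ^ toℕ i * (- 1#) ^ toℕ x)))) ⟩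
    pairing q (λ k → alternatingSum n (λ x → y x ^ k)) ∎

  -- The Cauchy product is linear in its left factor; applied with `f x` the series of eˣᵗ.
  alternatingSum-⊛ : ∀ n (f : ℕ → Series) g k →
                     ((λ j → alternatingSum n (λ x → f x j)) ⊛ g) k ≈ alternatingSum n (λ x → (f x ⊛ g) k)
  alternatingSum-⊛ n f g k = trans
    (sum-cong-≋ {suc k} λ j → alternatingSum-*ʳ n (λ x → f x (toℕ j)) (g (k ∸ toℕ j)))
    (alternatingSum-sum n {suc k} λ j x → f x (toℕ j) * g (k ∸ toℕ j))

-- Factorials in ℕ and their inverses in ℚ.

module Factorials where
  open IntEmbedding

  C-! : ∀ {n k} → k ℕ.≤ n → (n C k) ℕ.* (k ! ℕ.* (n ∸ k) !) ≡ n !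
  C-! {n} {k} k≤n = ≡.trans (≡.cong (ℕ._* (k ! ℕ.* (n ∸ k) !)) (nCk≡n!/k![n-k]! k≤n))
    (DivMod.m/n*n≡m {{k ℕP.!* (n ∸ k) !≢0}} (k![n∸k]!∣n! k≤n))

  nat-inverse : ∀ n → .{{_ : ℕ.NonZero n}} → nat n ℚ.* ((+ 1) ℚ./ n) ≡ 1ℚ
  nat-inverse n@(suc m) = ℚP.toℚᵘ-injective (begin
    ℚ.toℚᵘ (nat n ℚ.* ((+ 1) ℚ./ n))          ≈⟨ ℚP.toℚᵘ-homo-* (nat n) ((+ 1) ℚ./ n) ⟩
    ℚ.toℚᵘ (nat n) ℚᵘ.* ℚ.toℚᵘ ((+ 1) ℚ./ n)  ≈⟨ ℚᵘP.*-cong (toᵘ (+ n)) (ℚP.toℚᵘ-fromℚᵘ (ℚᵘ.mkℚᵘ (+ 1) m)) ⟩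
    ℚᵘ.mkℚᵘ (+ n) 0 ℚᵘ.* ℚᵘ.mkℚᵘ (+ 1) m      ≈⟨ ℚᵘ.*≡* (≡.trans (≡.trans (ℤP.*-identityʳ _) (ℤP.*-identityʳ (+ n)))
                                                              (≡.sym (≡.trans (ℤP.*-identityˡ _) (≡.cong +_ (ℕP.*-identityˡ n))))) ⟩
    ℚ.toℚᵘ 1ℚ                                 ∎)
    where open Relation.Binary.Reasoning.Setoid ℚᵘP.≃-setoid

-- Exponential series over a ℚ-algebra.

module ExponentialSeries (R : CommutativeRing c ℓ) (η : ℚ → CommutativeRing.Carrier R)
  (η-hom : RingMorphisms.IsRingHomomorphism (CommutativeRing.rawRing ℚP.+-*-commutativeRing) (CommutativeRing.rawRing R) η)
  where
  open CommutativeRing R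
  open RingMorphisms.IsRingHomomorphism η-hom
  open PowerSeries R
  open PowerSeriesProperties R
  open AlternatingSums R
  open Algebra.Properties.Semiring.Exp semiring using (_^_; ^-congˡ)
  open Algebra.Properties.Semiring.Mult semiring using (×1-homo-*; ×-congʳ; ×-comm-*; ×-assoc-*) renaming (_×_ to _·_)
  open Algebra.Properties.Semiring.Sum semiring
  open Algebra.Solver.Ring.NaturalCoefficients.Default commutativeSemiring using (solve; _:=_; _:*_)
  open Relation.Binary.Reasoning.Setoid setoid

  nat-suc : ∀ n → η (nat (suc n)) ≈ η (nat n) + 1#
  nat-suc n = begin
    η (nat (suc n))        ≡⟨ ≡.cong η (≡.trans (IntEmbedding.nat-+ 1 n) (ℚP.+-comm 1ℚ (nat n))) ⟩
    η (nat n ℚ.+ 1ℚ)       ≈⟨ +-homo (nat n) 1ℚ ⟩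
    η (nat n) + η 1ℚ       ≈⟨ +-congˡ 1#-homo ⟩
    η (nat n) + 1#         ∎

  η-nat : ∀ n → η (nat n) ≈ n · 1#
  η-nat zero    = 0#-homo
  η-nat (suc n) = trans (nat-suc n) (trans (+-comm _ _) (+-congˡ (η-nat n)))

  -- This and the series below restate the definitions over ℂₚ for an arbitrary ring with a
  -- homomorphism `η` from ℚ, so that the algebra takes place in an abstract ring.
  1/_! : ℕ → Carrier
  1/ k ! = η (((+ 1) ℚ./ (k !)) {{k ℕP.!≢0}})

  egf : (ℕ → Carrier) → Series
  egf a k = a k * 1/ k !

  exp : Carrier → Series
  exp y = egf (y ^_)

  !-inverse : ∀ k → (k !) · 1# * 1/ k ! ≈ 1#
  !-inverse k = begin
    (k !) · 1# * 1/ k !        ≈⟨ *-congʳ (η-nat (k !)) ⟨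
    η (nat (k !)) * 1/ k !     ≈⟨ *-homo _ _ ⟨
    η (nat (k !) ℚ.* (((+ 1) ℚ./ (k !)) {{k ℕP.!≢0}})) ≡⟨ ≡.cong η (Factorials.nat-inverse (k !) {{k ℕP.!≢0}}) ⟩
    η 1ℚ                       ≈⟨ 1#-homo ⟩
    1#                         ∎

  !·egf : ∀ a k → (k !) · egf a k ≈ a k
  !·egf a k = begin
    (k !) · (a k * 1/ k !)     ≈⟨ ×-congʳ (k !) (*-identityˡ _) ⟨
    (k !) · (1# * egf a k)     ≈⟨ ×-assoc-* (k !) 1# (egf a k) ⟨
    (k !) · 1# * (a k * 1/ k !) ≈⟨ solve 3 (λ x y z → x :* (y :* z) := y :* (x :* z)) refl ((k !) · 1#) (a k) (1/ k !) ⟩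
    a k * ((k !) · 1# * 1/ k !) ≈⟨ *-congˡ (!-inverse k) ⟩
    a k * 1#                   ≈⟨ *-identityʳ _ ⟩
    a k                        ∎

  egf-!· : ∀ f k → egf (λ j → (j !) · f j) k ≈ f k
  egf-!· f k = begin
    (k !) · f k * 1/ k !          ≈⟨ ×-assoc-* (k !) (f k) (1/ k !) ⟩
    (k !) · (f k * 1/ k !)        ≈⟨ !·egf f k ⟩
    f k                           ∎

  -- Insert 1 = n! · (1/n!), write n! as the binomial coefficient times k! (n - k)!, and cancel the
  -- last two factorials against their inverses.
  1/!-* : ∀ {n k} → k ℕ.≤ n → 1/ k ! * 1/ (n ∸ k) ! ≈ (n C k) · 1/ n !
  1/!-* {n} {k} k≤n = begin
    a * b                                  ≈⟨ *-identityʳ _ ⟨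
    a * b * 1#                             ≈⟨ *-congˡ (!-inverse n) ⟨
    a * b * ((n !) · 1# * e)                ≈⟨ *-congˡ (*-congʳ n!) ⟩
    a * b * ((n C k) · 1# * ((k !) · 1# * ((n ∸ k) !) · 1#) * e)
      ≈⟨ solve 6 (λ a b e x y z → a :* b :* (x :* (y :* z) :* e) := (y :* a) :* (z :* b) :* (x :* e)) refl
           a b e ((n C k) · 1#) ((k !) · 1#) (((n ∸ k) !) · 1#) ⟩
    (k !) · 1# * a * (((n ∸ k) !) · 1# * b) * ((n C k) · 1# * e)
      ≈⟨ *-congʳ (trans (*-cong (!-inverse k) (!-inverse (n ∸ k))) (*-identityˡ 1#)) ⟩
    1# * ((n C k) · 1# * e)                 ≈⟨ trans (*-identityˡ _) (×-assoc-* (n C k) 1# e) ⟩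
    (n C k) · (1# * e)                      ≈⟨ ×-congʳ (n C k) (*-identityˡ e) ⟩
    (n C k) · e                             ∎
    where
    a b e : Carrier
    a = 1/ k !
    b = 1/ (n ∸ k) !
    e = 1/ n !
    n! : (n !) · 1# ≈ (n C k) · 1# * ((k !) · 1# * ((n ∸ k) !) · 1#)
    n! = begin
      (n !) · 1#                                        ≡⟨ ≡.cong (_· 1#) (Factorials.C-! k≤n) ⟨
      ((n C k) ℕ.* (k ! ℕ.* (n ∸ k) !)) · 1#            ≈⟨ ×1-homo-* (n C k) (k ! ℕ.* (n ∸ k) !) ⟩
      (n C k) · 1# * ((k ! ℕ.* (n ∸ k) !) · 1#)         ≈⟨ *-congˡ (×1-homo-* (k !) ((n ∸ k) !)) ⟩
      (n C k) · 1# * ((k !) · 1# * ((n ∸ k) !) · 1#)    ∎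

  eᵗ : Series
  eᵗ = egf (λ _ → 1#)

  -- The law eʸᵗ eᵗ = e⁽ʸ⁺¹⁾ᵗ is the binomial theorem for (y + 1)ⁿ, divided by n!.
  exp-⊛ : ∀ y → exp y ⊛ eᵗ ≋ exp (y + 1#)
  exp-⊛ y n = begin
    (exp y ⊛ eᵗ) n                                   ≈⟨ sum-cong-≋ {suc n} term ⟩
    ∑[ k ≤ n ] ((n C toℕ k) · (y ^ toℕ k * 1# ^ (n ∸ toℕ k)) * 1/ n !)
      ≈⟨ *-distribʳ-sum {suc n} (1/ n !) (λ k → (n C toℕ k) · (y ^ toℕ k * 1# ^ (n ∸ toℕ k))) ⟨
    Binomial.binomialExpansion y 1# n * 1/ n !       ≈⟨ *-congʳ (Binomial.theorem n y 1#) ⟨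
    exp (y + 1#) n                                   ∎
    where
    module Binomial = Algebra.Properties.CommutativeSemiring.Binomial commutativeSemiring
    1^ : ∀ m → 1# ^ m ≈ 1#
    1^ zero    = refl
    1^ (suc m) = trans (*-identityˡ _) (1^ m)
    term : ∀ (k : Fin (suc n)) → exp y (toℕ k) * eᵗ (n ∸ toℕ k) ≈
                                 (n C toℕ k) · (y ^ toℕ k * 1# ^ (n ∸ toℕ k)) * 1/ n !
    term k = begin
      y ^ i * 1/ i ! * (1# * 1/ (n ∸ i) !)           ≈⟨ trans (*-congˡ (*-identityˡ _)) (*-assoc _ _ _) ⟩
      y ^ i * (1/ i ! * 1/ (n ∸ i) !)                ≈⟨ *-congˡ (1/!-* (FinP.toℕ≤pred[n] k)) ⟩
      y ^ i * (n C i) · 1/ n !                       ≈⟨ ×-comm-* (n C i) (y ^ i) (1/ n !) ⟩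
      (n C i) · (y ^ i * 1/ n !)                     ≈⟨ ×-assoc-* (n C i) (y ^ i) (1/ n !) ⟨
      -- The power of 1 is inserted to reach the shape of the binomial expansion of y + 1.
      (n C i) · (y ^ i) * 1/ n !                     ≈⟨ *-congʳ (×-congʳ (n C i) (trans (*-congˡ (1^ (n ∸ i))) (*-identityʳ _))) ⟨
      (n C i) · (y ^ i * 1# ^ (n ∸ i)) * 1/ n !      ∎
      where
      i : ℕ
      i = toℕ k

  eᵗ+1 : Series
  eᵗ+1 = eᵗ ⊕ constant 1#

  exp-cong : ∀ {y z} → y ≈ z → exp y ≋ exp z
  exp-cong y≈z k = *-congʳ (^-congˡ k y≈z)

  exp-⊛-eᵗ+1 : ∀ y → exp y ⊛ eᵗ+1 ≋ exp y ⊕ exp (y + 1#)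
  exp-⊛-eᵗ+1 y k = begin
    (exp y ⊛ eᵗ+1) k                              ≈⟨ ⊛-distribˡ (exp y) eᵗ (constant 1#) k ⟩
    (exp y ⊛ eᵗ) k + (exp y ⊛ constant 1#) k      ≈⟨ +-cong (exp-⊛ y k) (trans (⊛-constant (exp y) 1# k) (*-identityʳ _)) ⟩
    exp (y + 1#) k + exp y k                      ≈⟨ +-comm _ _ ⟩
    exp y k + exp (y + 1#) k                      ∎

  exp-0 : exp 0# ≋ constant 1#
  exp-0 zero    = trans (*-identityˡ _) 1#-homo
  exp-0 (suc k) = trans (*-congʳ (zeroˡ _)) (zeroˡ _)

  powerSum : ℕ → ℕ → Carrier
  powerSum n k = alternatingSum n (λ x → η (nat x) ^ k)

  powerSum-⊛-eᵗ+1 : ∀ n → 2 ∤ n → egf (powerSum n) ⊛ eᵗ+1 ≋ exp 0# ⊕ exp (η (nat n))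
  powerSum-⊛-eᵗ+1 n 2∤n k = begin
    (egf (powerSum n) ⊛ eᵗ+1) k
      ≈⟨ sum-cong-≋ {suc k} (λ j → *-congʳ {eᵗ+1 (k ∸ toℕ j)} (alternatingSum-*ʳ n (λ x → η (nat x) ^ toℕ j) (1/ toℕ j !))) ⟩
    ((λ j → alternatingSum n (λ x → exp (η (nat x)) j)) ⊛ eᵗ+1) k
      ≈⟨ alternatingSum-⊛ n (λ x → exp (η (nat x))) eᵗ+1 k ⟩
    alternatingSum n (λ x → (exp (η (nat x)) ⊛ eᵗ+1) k)
      -- Since η (x + 1) = η x + 1, the second exponential is the next term of the same sequence in
      -- x, as telescoping requires.
      ≈⟨ alternatingSum-cong n (λ x → trans (exp-⊛-eᵗ+1 (η (nat x)) k) (+-congˡ (exp-cong (sym (nat-suc x)) k))) ⟩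
    alternatingSum n (λ x → exp (η (nat x)) k + exp (η (nat (suc x))) k)
      ≈⟨ alternatingSum-telescope-odd n 2∤n (λ x → exp (η (nat x)) k) ⟩
    exp (η 0ℚ) k + exp (η (nat n)) k
      ≈⟨ +-congʳ (exp-cong 0#-homo k) ⟩
    exp 0# k + exp (η (nat n)) k ∎

-- Convergence of alternating power sums.

module PowerSumLimits (A : SeminormedRing c ℓ r) (η : ℚ → SeminormedRing.Carrier A)
  (η-hom : RingMorphisms.IsRingHomomorphism (CommutativeRing.rawRing ℚP.+-*-commutativeRing) (SeminormedRing.rawRing A) η)
  where
  open SeminormedRing A
  open Polynomials commutativeRing
  open PowerSeries commutativeRing
  open Limits A
  open PolynomialPairing commutativeRing
  open AlternatingSums commutativeRing
  open ExponentialSeries commutativeRing η η-hom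
  open HalfInverse commutativeRing η η-hom using (two-invertible)
  open Algebra.Properties.Semiring.Mult semiring using (×-congʳ) renaming (_×_ to _·_)
  open Relation.Binary.Reasoning.Setoid setoid

  2/eᵗ+1 : Series
  2/eᵗ+1 = quotient (constant (1# + 1#)) eᵗ+1 two-invertible

  -- The numbers aₖ in f = Σₖ aₖ tᵏ/k!, hence the values ⟨ f ∣ xᵏ ⟩.
  moments : Series → ℕ → Carrier
  moments f k = (k !) · f k

  moments-cong : ∀ {f g} → f ≋ g → ∀ k → moments f k ≈ moments g k
  moments-cong f≋g k = ×-congʳ (k !) (f≋g k)

  pairing-moments-x^ : ∀ {f E} → f ≋ egf E → ∀ k → E k ≈ pairing (x^ k) (moments f)
  pairing-moments-x^ {f} {E} f≋egfE k = begin
    E k                          ≈⟨ !·egf E k ⟨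
    moments (egf E) k            ≈⟨ moments-cong f≋egfE k ⟨
    moments f k                  ≈⟨ pairing-x^ k (moments f) ⟨
    pairing (x^ k) (moments f)   ∎

  -- A series is determined by its values on the powers of x, because every k! is invertible.
  egf-unique : ∀ {f} μ → (∀ k → μ k ≈ pairing (x^ k) (moments f)) → egf μ ≋ f
  egf-unique {f} μ μ≈ k = begin
    egf μ k                              ≈⟨ *-congʳ (μ≈ k) ⟩
    pairing (x^ k) (moments f) * 1/ k !  ≈⟨ *-congʳ (pairing-x^ k (moments f)) ⟩
    egf (moments f) k                    ≈⟨ egf-!· f k ⟩
    f k                                  ∎

  module AlongNullSequence (n : ℕ → ℕ) (2∤n : ∀ N → 2 ∤ n N) (n⟶0 : (λ N → η (nat (n N))) ⟶ 0#) where

    evalSum : Polynomial → ℕ → Carrier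
    evalSum q N = alternatingSum (n N) (λ x → eval q (η (nat x)))

    egf-powerSum-⟶ : ∀ k → (λ N → egf (powerSum (n N)) k) ⟶ 2/eᵗ+1 k
    egf-powerSum-⟶ = ⟶-quotient eᵗ+1 two-invertible {λ N → egf (powerSum (n N))} {constant (1# + 1#)} λ k →
      ⟶-cong (λ N → sym (powerSum-⊛-eᵗ+1 (n N) (2∤n N) k)) (exp-0-doubled k)
        -- The limit `0# ^ k * 1/ k !` is `exp 0# k` by definition, so k = 0, where the power is
        -- constantly 1, needs no separate case.
        (⟶-+ (⟶-const (exp 0# k)) (⟶-* (⟶-^ n⟶0 k) (⟶-const (1/ k !))))
      where
      exp-0-doubled : ∀ k → exp 0# k + exp 0# k ≈ constant (1# + 1#) k
      exp-0-doubled zero    = +-cong (exp-0 0) (exp-0 0)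
      exp-0-doubled (suc k) = trans (+-cong (exp-0 (suc k)) (exp-0 (suc k))) (+-identityˡ 0#)

    powerSum-⟶ : ∀ k → (λ N → powerSum (n N) k) ⟶ moments 2/eᵗ+1 k
    powerSum-⟶ k = ⟶-cong (λ N → !·egf (powerSum (n N)) k) refl (⟶-· (k !) (egf-powerSum-⟶ k))

    -- Stated for any `f` with the same coefficients so that the copy of 2/(eᵗ + 1) defined over ℂₚ
    -- can take its place.
    evalSum-⟶ : ∀ {f} → 2/eᵗ+1 ≋ f → ∀ q → evalSum q ⟶ pairing q (moments f)
    evalSum-⟶ ≋f q = ⟶-cong (λ N → sym (alternatingSum-eval q (n N) (λ x → η (nat x)))) (pairing-cong q (moments-cong ≋f))
      (⟶-sum {length q} λ i → ⟶-* (⟶-const (lookup q i)) (powerSum-⟶ (toℕ i)))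

-- Definiteness of the norm on a completion.

module CompletionDefinite (A : SeminormedRing c ℓ r) where
  open SeminormedRing A
  open UltrametricLemmas A
  open Completion A using (norm<; completion; seq)

  -- Equality with 0 in the completion means being a null sequence, and bounds by every ε > 0 say
  -- just that.
  definite : ∀ {x} → (∀ {ε} → 0ℚ ℚ.< ε → norm< x ε) → SeminormedRing._≈_ completion x (SeminormedRing.0# completion)
  definite small ε ε>0 = let δ , δ<ε , N , bound = small ε>0 in
    N , λ n N≤n → resp (sym (sub-zero _)) (upward (ℚP.<⇒≤ δ<ε) (bound n N≤n))

-- Powers of p: parity and p-adic size.

module PrimePowers (p : ℕ) (p-prime : Prime p) where
  open Padic p p-prime
  open SeminormedRing ℚ-padic using (zero-norm)

  odd-^ : 2 ∤ p → ∀ N → 2 ∤ p ℕ.^ N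
  odd-^ 2∤p zero    2∣1 = contradiction (Div.∣1⇒≡1 2∣1) λ ()
  odd-^ 2∤p (suc N) 2∣p^ with euclidsLemma p (p ℕ.^ N) prime[2] 2∣p^
  ... | inj₁ 2∣p   = 2∤p 2∣p
  ... | inj₂ 2∣p^N = odd-^ 2∤p N 2∣p^N

  -- A witness of ∣ 0 ∣ₚ< ε already contains exponents with 1 ≤ pʲ < ε pⁱ.
  ^-small : ∀ {ε} → 0ℚ ℚ.< ε → ∃ λ i → ∀ N → i ℕ.≤ N → ∣ nat (p ℕ.^ N) ∣ₚ< ε
  ^-small {ε} ε>0 with zero-norm ε>0
  ... | mkBound i j _ _ _ _ pʲ<εpⁱ = i , λ N i≤N → mkBound N 0 (+ 1) 1
      (λ p∣1 → ℕ.nonTrivial⇒≢1 {{prime⇒nonTrivial p-prime}} (Div.∣1⇒≡1 p∣1))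
      (ℚP.*-comm (nat (p ℕ.^ N)) 1ℚ)
      (ℚP.≤-<-trans (nat-≤ (ℕP.m^n>0 p j)) (ℚP.<-≤-trans pʲ<εpⁱ
        (ℚP.*-monoˡ-≤-nonNeg ε (nat-≤ (ℕP.^-monoʳ-≤ p i≤N)))))
    where
    instance
      p≢0 : ℕ.NonZero p
      p≢0 = prime⇒nonZero p-prime
      ε≥0 : ℚ.NonNegative ε
      ε≥0 = ℚP.pos⇒nonNeg ε {{ℚ.positive ε>0}}
    nat-≤ : ∀ {m n} → m ℕ.≤ n → nat m ℚ.≤ nat n
    nat-≤ m≤n with ℕP.m≤n⇒m<n∨m≡n m≤n
    ... | inj₁ m<n    = ℚP.<⇒≤ (IntEmbedding.nat-< m<n)
    ... | inj₂ ≡.refl = ℚP.≤-refl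

-- Fermionic integrals of polynomials and Euler numbers.

theorem2p1 : ∀ {c ℓ₁ ℓ₂ r : Level} (p : ℕ) (p-prime : Prime p) → 2 ∤ p →
    (K : AlgebraicClosure p p-prime c ℓ₁ ℓ₂ r) →
    let open Fermionic p p-prime K in
    (∃ λ (μ : ℕ → ℂₚ.Carrier) → (∀ k → ∫ polynomialMap (x^ k) dμ₋₁≈ μ k)) ×
    (∀ (μ : ℕ → ℂₚ.Carrier) → (∀ k → ∫ polynomialMap (x^ k) dμ₋₁≈ μ k) →
    (egf μ ≋ 2/eᵗ+1) ×
    (∀ (q : Polynomial) → ∫ polynomialMap q dμ₋₁≈ ⟨ egf μ ∣ q ⟩) ×
    (∀ (q : Polynomial) → ∫ polynomialMap q dμ₋₁≈ ⟨ 2/eᵗ+1 ∣ q ⟩) ×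
    (∀ (E : ℕ → ℂₚ.Carrier) → IsEulerSequence E → ∀ n → E n ℂₚ.≈ ⟨ egf μ ∣ x^ n ⟩))
-- The moments exist because `∫≈` computes them from 2/(eᵗ + 1); any other choice `μ` is compared
-- with these by uniqueness of limits.
theorem2p1 p p-prime 2∤p K = ((λ k → ⟨ 2/eᵗ+1 ∣ x^ k ⟩) , λ k → ∫≈ (x^ k)) , λ μ ∫≈μ →
  egf≋ μ ∫≈μ , ∫≈egf μ ∫≈μ , ∫≈ , euler μ ∫≈μ
  where
  open Fermionic p p-prime K
  open PrimePowers p p-prime
  module K = AlgebraicClosure K
  module Moments = PowerSumLimits ℂₚ-ring ℚ→ℂₚ ℚ→ℂₚ-isRingHomomorphism
  open Limits ℂₚ-ring
  open PolynomialPairing ℂₚ.commutativeRing using (pairing-cong)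
  open Algebra.Properties.Semiring.Sum ℂₚ.semiring using (sum-cong-≋)

  -- The p-adic bound on pᴺ in ℚ is carried along ℚ → ℚₚ → ℂₚ, both maps preserving such bounds.
  p^N⟶0 : (λ N → ℚ→ℂₚ (nat (p ℕ.^ N))) ℂₚ.⟶ ℂₚ.0#
  p^N⟶0 ε ε>0 = let i , bound = ^-small ε>0 in i , λ N i≤N →
    ℂₚ.resp {ℚ→ℂₚ (nat (p ℕ.^ N))} {ℚ→ℂₚ (nat (p ℕ.^ N)) ℂₚ.- ℂₚ.0#} {ε}
      (ℂₚ.sym {ℚ→ℂₚ (nat (p ℕ.^ N)) ℂₚ.- ℂₚ.0#} {ℚ→ℂₚ (nat (p ℕ.^ N))}
        (UltrametricLemmas.sub-zero ℂₚ-ring (ℚ→ℂₚ (nat (p ℕ.^ N)))))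
      (ℚₚ→ℂₚ-isometric {ℚ̂.const (nat (p ℕ.^ N))} {ε} (ℚ̂.const-norm {nat (p ℕ.^ N)} {ε} (bound N i≤N)))

  module Sums = Moments.AlongNullSequence (p ℕ.^_) (odd-^ 2∤p) p^N⟶0

  -- The two sides are definitionally equal, but Agda would compare the Cauchy
  -- proofs inside each product; equality in ℂₚ only looks at the sequences.
  evalSum≈partialSum : ∀ q N → Sums.evalSum q N ℂₚ.≈ partialSum (polynomialMap q) N
  evalSum≈partialSum q N = sum-cong-≋ {p ℕ.^ N} λ i ε ε>0 → 0 , λ n _ →
    UltrametricLemmas.dist-≈ K.seminormedRing ε>0 K.refl

  ∫≈ : ∀ q → ∫ polynomialMap q dμ₋₁≈ ⟨ 2/eᵗ+1 ∣ q ⟩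
  ∫≈ q = ⟶-cong {Sums.evalSum q} {partialSum (polynomialMap q)} {⟨ 2/eᵗ+1 ∣ q ⟩} {⟨ 2/eᵗ+1 ∣ q ⟩}
    (evalSum≈partialSum q) (ℂₚ.refl {⟨ 2/eᵗ+1 ∣ q ⟩}) (Sums.evalSum-⟶ {2/eᵗ+1} (λ k → ℂₚ.refl {2/eᵗ+1 k}) q)

  module _ (μ : ℕ → ℂₚ.Carrier) (∫≈μ : ∀ k → ∫ polynomialMap (x^ k) dμ₋₁≈ μ k) where

    -- Both `μ k` and ⟨ 2/(eᵗ + 1) ∣ xᵏ ⟩ are limits of the same partial sums, so the two series
    -- have equal moments.
    egf≋ : egf μ ≋ 2/eᵗ+1
    egf≋ = Moments.egf-unique {2/eᵗ+1} μ λ k →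
      ⟶-unique (λ {x} → CompletionDefinite.definite K.seminormedRing {x})
        {partialSum (polynomialMap (x^ k))} {μ k} {⟨ 2/eᵗ+1 ∣ x^ k ⟩} (∫≈μ k) (∫≈ (x^ k))

    ∫≈egf : ∀ q → ∫ polynomialMap q dμ₋₁≈ ⟨ egf μ ∣ q ⟩
    ∫≈egf q = ⟶-cong {partialSum (polynomialMap q)} {partialSum (polynomialMap q)} {⟨ 2/eᵗ+1 ∣ q ⟩} {⟨ egf μ ∣ q ⟩}
      (λ N → ℂₚ.refl {partialSum (polynomialMap q) N})
      (pairing-cong q {Moments.moments 2/eᵗ+1} {Moments.moments (egf μ)}
         (Moments.moments-cong {2/eᵗ+1} {egf μ} λ k → ℂₚ.sym {egf μ k} {2/eᵗ+1 k} (egf≋ k)))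
      (∫≈ q)

    euler : ∀ E → IsEulerSequence E → ∀ n → E n ℂₚ.≈ ⟨ egf μ ∣ x^ n ⟩
    euler E isEuler = Moments.pairing-moments-x^ {egf μ} {E} λ k →
      ℂₚ.trans {egf μ k} {2/eᵗ+1 k} {egf E k} (egf≋ k) (isEuler k)
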